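{- For any (fixed) integer $k\ge3$, Negative-Weight $k$-Clique parameterized by the number $n$ of vertices is $k$-OR-decomposable.
   Context: The notation $\widetilde O$ hides polylogarithmic factors. Negative-Weight $k$-Clique: given an edge-weighted graph $G$ on $n$ vertices, decide whether $G$ contains a $k$-clique of negative weight, i.e., a clique on $k$ vertices such that the sum of the weights of the edges within the clique is negative. Here $k$ is a constant. OR-decomposition: for $\alpha>1$, an $\alpha$-OR-decomposition for a problem $\mathcal P$ with parameter $n$ (a set of pairs $(I,n)$) is an algorithm that, given $\lambda>0$ and an instance $(I,n)$ of $\mathcal P$, computes, for some $\alpha'<\alpha$, in $\widetilde O(n^{\alpha'})$ time $t\in\widetilde O(n^{\alpha\lambda/(\alpha+\lambda)})$ many instances $(I_1,n_1),\dots,(I_t,n_t)$ of $\mathcal P$ such that (i) $(I,n)\in\mathcal P$ if and only if $(I_i,n_i)\in\mathcal P$ for some $i\in\{1,\dots,t\}$, and (ii) $n_i\in\widetilde O(n^{\alpha/(\alpha+\lambda)})$ for all $i$. The problem $\mathcal P$ is $\alpha$-OR-decomposable if an $\alpha$-OR-decomposition for it exists. -}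

module Defs where

open import Data.Bool.Base using (if_then_else_)
open import Data.Fin.Base using (Fin; toℕ)
open import Data.Integer.Base as ℤ using (ℤ; +_; -[1+_]; 0ℤ)
open import Data.Integer.Properties using (+-0-commutativeMonoid)
open import Algebra.Properties.CommutativeMonoid.Sum +-0-commutativeMonoid using (sum)
open import Data.List.Base using (List; []; _∷_; _++_; concat; foldr; length; lookup; map; tabulate)
open import Data.List.Relation.Unary.Any using (Any)
open import Data.Maybe using (Maybe; just; nothing; fromMaybe; Is-just)
open import Data.Nat.Base
open import Data.Nat.Logarithm using (⌈log₂_⌉)
import Data.Nat.Properties as ℕₚ
open import Data.Product.Base using (Σ-syntax; ∃; ∃-syntax; _×_; _,_; proj₁)
open import Data.Rational.Unnormalised.Base as ℚ using (ℚᵘ; mkℚᵘ; 0ℚᵘ; ↥_; ↧ₙ_)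
open import Function.Bundles using (_⇔_)
open import Function.Definitions using (Injective)
open import Relation.Binary.PropositionalEquality using (_≡_; _≢_; sym; trans; cong; subst)

------------------------------------------------------------------------
-- Non-negative real numbers

-- Bishop's regular sequences, with m-th term approx m / m: regularity is
-- | approx m / m - approx n / n | ≤ 1/m + 1/n with denominators cleared.
-- The real x represented is the one with | approx m - m x | ≤ 1 for all m;
-- every real x ≥ 0 arises, for instance from approx m = ⌊ m x ⌋.

record ℝ≥0 : Set where
  field
    approx  : ℕ → ℕ
    regular : ∀ m n → ∣ n * approx m - m * approx n ∣ ≤ m + n

open ℝ≥0 public

fromℕ : ℕ → ℝ≥0
fromℕ k .approx m = m * k
fromℕ k .regular m n = subst (_≤ m + n) (sym (ℕₚ.m≡n⇒∣m-n∣≡0 nmk≡mnk)) z≤n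
  where
  nmk≡mnk : n * (m * k) ≡ m * (n * k)
  nmk≡mnk = trans (sym (ℕₚ.*-assoc n m k))
                  (trans (cong (_* k) (ℕₚ.*-comm n m)) (ℕₚ.*-assoc m n k))

infix 4 _<ʳ_ _<ʳᵠ_ _<ᵠʳ_

-- x < y iff for some m the error intervals of x and y at precision 1/m are
-- disjoint and in this order (m = 0 never qualifies, as approx x 0 ≤ 1).

_<ʳ_ : ℝ≥0 → ℝ≥0 → Set
x <ʳ y = ∃[ m ] approx x m + 2 < approx y m

-- Comparison with a rational; the m-th term has index suc m here, and
-- mkℚᵘ a m is a / suc m.

_<ʳᵠ_ : ℝ≥0 → ℚᵘ → Set
x <ʳᵠ r = ∃[ m ] mkℚᵘ (+ approx x (suc m) ℤ.+ + 1) m ℚ.< r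

_<ᵠʳ_ : ℚᵘ → ℝ≥0 → Set
r <ᵠʳ x = ∃[ m ] r ℚ.< mkℚᵘ (+ approx x (suc m) ℤ.- + 1) m

------------------------------------------------------------------------
-- Real exponents and Õ

-- A non-negative real exponent is given by its upper cut, the set of all
-- rationals strictly above it.

Exponent : Set₁
Exponent = ℚᵘ → Set

exponent : ℝ≥0 → Exponent
exponent x r = x <ʳᵠ r

-- αβ/(α+β), for β > 0.  The quotient is strictly increasing in both α and β,
-- so r exceeds it iff r ≥ ab/(a+b) for some rationals a > α and b > β.

αβ/[α+β] : ℝ≥0 → ℝ≥0 → Exponent
αβ/[α+β] α β r =
  ∃[ a ] ∃[ b ] α <ʳᵠ a × β <ʳᵠ b × a ℚ.* b ℚ.≤ r ℚ.* (a ℚ.+ b)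

-- α/(α+β), for β > 0, which is increasing in α and decreasing in β.

α/[α+β] : ℝ≥0 → ℝ≥0 → Exponent
α/[α+β] α β r =
  ∃[ a ] ∃[ b ] α <ʳᵠ a × 0ℚᵘ ℚ.≤ b × b <ᵠʳ β × a ℚ.≤ r ℚ.* (a ℚ.+ b)

-- v ≤ M · n^x, for n ≥ 1 and x with upper cut E: by continuity this holds iff
-- v ≤ M · n^(p/q), i.e. v^q ≤ M^q · n^p, for all rationals p/q > x.  All such
-- p are positive, since x ≥ 0.

_≤_·_^ᴱ_ : ℕ → ℕ → ℕ → Exponent → Set
v ≤ M · n ^ᴱ E = ∀ r → E r → v ^ ↧ₙ r ≤ M ^ ↧ₙ r * n ^ ℤ.∣ ↥ r ∣

-- f ∈ Õ(n^E): the bound is uniform over all a in A n, such as all instances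
-- with parameter n.

Õ : {A : ℕ → Set} → (∀ n → A n → ℕ) → Exponent → Set
Õ {A} f E = ∃[ C ] ∃[ d ] ∃[ n₀ ] ∀ n → n₀ ≤ n → (a : A n) →
  f n a ≤ C * ⌈log₂ n ⌉ ^ d · n ^ᴱ E

------------------------------------------------------------------------
-- Word RAM

-- Structured programs over registers and a random-access memory.  Tests
-- succeed on nonzero values.  Words are the natural numbers below a bound,
-- 2^w for word size w; the semantics lets a program store or print only words.
-- (Intermediate results within an expression may exceed the bound, but since
-- a program's expressions have fixed depth they still have O(w) bits.)

data Op : Set where
  plus monus times div mod less : Op

data Expr : Set where
  lit   : ℕ → Expr
  reg   : ℕ → Expr
  load  : Expr → Expr
  op    : Op → Expr → Expr → Expr
  -- The real parameter λ of the program, up to additive error 1/m, is read as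
  -- the integer approx λ m.
  query : Expr → Expr

infixr 5 _⨟_

data Program : Set where
  skip  : Program
  set   : (register : ℕ) (value : Expr) → Program
  store : (address value : Expr) → Program
  print : Expr → Program
  _⨟_   : Program → Program → Program
  ifnz  : Expr → (then-branch else-branch : Program) → Program
  while : Expr → (body : Program) → Program

-- Division and remainder by 0 return 0.

⟦_⟧ᵒ : Op → ℕ → ℕ → ℕ
⟦ plus  ⟧ᵒ a b       = a + b
⟦ monus ⟧ᵒ a b       = a ∸ b
⟦ times ⟧ᵒ a b       = a * b
⟦ div   ⟧ᵒ a zero    = 0
⟦ div   ⟧ᵒ a (suc b) = a / suc b
⟦ mod   ⟧ᵒ a zero    = 0
⟦ mod   ⟧ᵒ a (suc b) = a % suc b
⟦ less  ⟧ᵒ a b       = if a <ᵇ b then 1 else 0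

record State : Set where
  constructor ⟨_,_⟩
  field
    registers memory : ℕ → ℕ

open State public

_[_↦_] : (ℕ → ℕ) → ℕ → ℕ → (ℕ → ℕ)
(f [ i ↦ v ]) j = if i ≡ᵇ j then v else f j

-- Each node of an expression costs one time unit.

size : Expr → ℕ
size (lit _)    = 1
size (reg _)    = 1
size (load e)   = suc (size e)
size (op _ e f) = suc (size e + size f)
size (query e)  = suc (size e)

module Semantics (ℓ : ℝ≥0) (bound : ℕ) where

  ⟦_⟧ : Expr → State → ℕ
  ⟦ lit c ⟧    s = c
  ⟦ reg i ⟧    s = registers s i
  ⟦ load e ⟧   s = memory s (⟦ e ⟧ s)
  ⟦ op o e f ⟧ s = ⟦ o ⟧ᵒ (⟦ e ⟧ s) (⟦ f ⟧ s)
  ⟦ query e ⟧  s = approx ℓ (⟦ e ⟧ s)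

  -- Exec P s s′ ws t: started in state s, program P halts in state s′ after
  -- t time units, having printed the words ws.

  data Exec : Program → State → State → List ℕ → ℕ → Set where
    skip    : ∀ {s} → Exec skip s s [] 1
    set     : ∀ {s i e} → ⟦ e ⟧ s < bound →
              Exec (set i e) s ⟨ registers s [ i ↦ ⟦ e ⟧ s ] , memory s ⟩
                   [] (suc (size e))
    store   : ∀ {s e f} → ⟦ e ⟧ s < bound → ⟦ f ⟧ s < bound →
              Exec (store e f) s ⟨ registers s , memory s [ ⟦ e ⟧ s ↦ ⟦ f ⟧ s ] ⟩
                   [] (suc (size e + size f))
    print   : ∀ {s e} → ⟦ e ⟧ s < bound →
              Exec (print e) s s (⟦ e ⟧ s ∷ []) (suc (size e))
    seq     : ∀ {P Q s s′ s″ ws ws′ t t′} →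
              Exec P s s′ ws t → Exec Q s′ s″ ws′ t′ →
              Exec (P ⨟ Q) s s″ (ws ++ ws′) (t + t′)
    if-then : ∀ {e P Q s s′ ws t} → ⟦ e ⟧ s ≢ 0 → Exec P s s′ ws t →
              Exec (ifnz e P Q) s s′ ws (suc (size e + t))
    if-else : ∀ {e P Q s s′ ws t} → ⟦ e ⟧ s ≡ 0 → Exec Q s s′ ws t →
              Exec (ifnz e P Q) s s′ ws (suc (size e + t))
    stop    : ∀ {e P s} → ⟦ e ⟧ s ≡ 0 →
              Exec (while e P) s s [] (suc (size e))
    loop    : ∀ {e P s s′ s″ ws ws′ t t′} → ⟦ e ⟧ s ≢ 0 →
              Exec P s s′ ws t → Exec (while e P) s′ s″ ws′ t′ →
              Exec (while e P) s s″ (ws ++ ws′) (suc (size e + (t + t′)))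

-- The input occupies the memory cells from 0 on; everything else is 0.

cells : List ℕ → ℕ → ℕ
cells []       _       = 0
cells (w ∷ ws) zero    = w
cells (w ∷ ws) (suc i) = cells ws i

initial : List ℕ → State
initial ws = ⟨ (λ _ → 0) , cells ws ⟩

------------------------------------------------------------------------
-- Parameterized problems and OR-decompositions

record Problem : Set₁ where
  field
    Instance : ℕ → Set                       -- instances with parameter n
    Yes      : ∀ {n} → Instance n → Set      -- (I , n) belongs to the problem
    encode   : ∀ {n} → Instance n → List ℕ   -- input and output format

module _ (𝒫 : Problem) where
  open Problem 𝒫

  encodeAll : List (∃ Instance) → List ℕ
  encodeAll Is = length Is ∷ concat (map (λ (n , I) → encode I) Is)

  -- Word size c · log₂(…), large enough to hold the parameter, the input
  -- length and each input word (and small powers of these).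

  wordBound : ℕ → ∀ {n} → Instance n → ℕ
  wordBound c {n} I = (2 + foldr _⊔_ (n ⊔ length (encode I)) (encode I)) ^ c

  record Run (A : Program) (ℓ : ℝ≥0) (c : ℕ) {n : ℕ} (I : Instance n) : Set where
    open Semantics ℓ (wordBound c I)
    field
      parts   : List (∃ Instance)
      time    : ℕ
      final   : State
      run     : Exec A (initial (encode I)) final (encodeAll parts) time
      correct : Yes I ⇔ Any (λ (n , J) → Yes J) parts

  open Run

  -- A single program A works for all λ > 0 (written ℓ); the exponent α′, the
  -- constant in the word size and those hidden by Õ may depend on λ.

  IsORDecomposition : ℝ≥0 → Program → Set
  IsORDecomposition α A = (ℓ : ℝ≥0) → fromℕ 0 <ʳ ℓ →
    Σ[ α′ ∈ ℝ≥0 ] α′ <ʳ α ×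
    (Σ[ c ∈ ℕ ] Σ[ R ∈ (∀ n (I : Instance n) → Run A ℓ c I) ]
      Õ {Instance} (λ n I → time (R n I)) (exponent α′) ×
      Õ {Instance} (λ n I → length (parts (R n I))) (αβ/[α+β] α ℓ) ×
      Õ {λ n → Σ[ I ∈ Instance n ] Fin (length (parts (R n I)))}
        (λ n (I , i) → proj₁ (lookup (parts (R n I)) i)) (α/[α+β] α ℓ))

  OR-Decomposable : ℝ≥0 → Set
  OR-Decomposable α = fromℕ 1 <ʳ α × ∃[ A ] IsORDecomposition α A

------------------------------------------------------------------------
-- Negative-Weight k-Clique

-- Simple undirected graphs on the vertices Fin n with integer edge weights;
-- nothing stands for a non-edge.

record WeightedGraph (n : ℕ) : Set where
  field
    edge      : Fin n → Fin n → Maybe ℤ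
    symmetric : ∀ u v → edge u v ≡ edge v u
    loopless  : ∀ v → edge v v ≡ nothing

  Adjacent : Fin n → Fin n → Set
  Adjacent u v = Is-just (edge u v)

  weight : Fin n → Fin n → ℤ
  weight u v = fromMaybe 0ℤ (edge u v)

open WeightedGraph public

record Clique (k : ℕ) {n : ℕ} (G : WeightedGraph n) : Set where
  field
    vertex   : Fin k → Fin n
    distinct : Injective _≡_ _≡_ vertex
    adjacent : ∀ i j → i ≢ j → Adjacent G (vertex i) (vertex j)

  -- Each edge is counted once, as a pair i < j.

  cliqueWeight : ℤ
  cliqueWeight = sum λ i → sum λ j →
    if toℕ i <ᵇ toℕ j then weight G (vertex i) (vertex j) else 0ℤ

open Clique public

HasNegativeClique : ℕ → ∀ {n} → WeightedGraph n → Set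
HasNegativeClique k G = Σ[ K ∈ Clique k G ] cliqueWeight K ℤ.< 0ℤ

-- One word per matrix entry.

encodeEntry : Maybe ℤ → ℕ
encodeEntry nothing         = 0
encodeEntry (just (+ m))    = 1 + 2 * m
encodeEntry (just -[1+ m ]) = 2 + 2 * m

-- The number of vertices, followed by the matrix in row-major order.

encodeGraph : ∀ {n} → WeightedGraph n → List ℕ
encodeGraph {n} G =
  n ∷ concat (tabulate λ u → tabulate λ v → encodeEntry (edge G u v))

NegativeWeightClique : ℕ → Problem
NegativeWeightClique k = record
  { Instance = WeightedGraph
  ; Yes      = HasNegativeClique k
  ; encode   = encodeGraph
  }

{-# OPTIONS --safe #-}
module Submission where

-- Let l = ⌊log₂ n⌋ and let j be l k / (k + λ) rounded down, with λ read to precision 1/n,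
-- which moves j by a constant only.  Cover the vertices by 2^(l + 1 - j) groups of size
-- s = 2^j.  Every k-clique meets at most k groups, so it suffices to output, for each k-tuple
-- of groups, the graph induced on them.  If a group occurs repeatedly in the tuple, its copies
-- of a vertex are not adjacent, as G is loopless: the part is the pullback of G along a map from
-- k s vertices, and this yields no new cliques.  Since 2^j and 2^(k (l - j)) are
-- n^(k / (k + λ)) and n^(k λ / (k + λ)) up to constants, the output has total size
-- O(n^(k (λ + 2) / (k + λ))), and λ + 2 < k + λ.

open import Data.Bool.Base using (true; false; T; if_then_else_)
open import Data.Fin.Base using (Fin; zero; suc; toℕ; fromℕ<)
open import Data.Fin.Properties as Finₚ using (toℕ-fromℕ<; toℕ-injective; toℕ<n)
open import Data.Integer.Base as ℤ using (+_; -[1+_]; 0ℤ)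
import Data.Integer.Properties as ℤₚ
open import Algebra.Properties.CommutativeMonoid.Sum ℤₚ.+-0-commutativeMonoid using (sum-cong-≗)
open import Data.List.Base using (List; []; _∷_; _++_; applyUpTo; concat; foldr; length; lookup; tabulate)
open import Data.List.Properties using (++-identityʳ; length-applyUpTo; lookup-applyUpTo; map-applyUpTo; tabulate-cong)
open import Data.List.Relation.Unary.Any using (Any)
open import Data.List.Relation.Unary.Any.Properties using (applyUpTo⁺; applyUpTo⁻)
open import Data.Maybe using (Is-just)
open import Data.Nat.Base
open import Data.Nat.Divisibility using (n∣m*n)
open import Data.Nat.DivMod hiding (_mod_; _div_)
open import Data.Nat.Properties
open import Data.Nat.Tactic.RingSolver using (solve-∀)
open import Data.Product.Base using (∃; ∃-syntax; _×_; _,_; proj₁; proj₂)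
open import Data.Rational.Unnormalised.Base as ℚ using (ℚᵘ; mkℚᵘ; ↥_; ↧ₙ_)
open import Data.Sum.Base using (_⊎_; inj₁; inj₂)
open import Data.Unit.Base using (⊤; tt)
open import Function.Base using (_∘_; id)
open import Function.Bundles using (_⇔_; mk⇔)
open import Relation.Binary.PropositionalEquality
  using (_≡_; _≢_; _≗_; refl; sym; trans; cong; cong₂; subst; subst₂)
open import Relation.Nullary using (¬_; contradiction; yes; no)
open import Defs
open ≤-Reasoning hiding (stop)

-- Rational bounds on real exponents

-- A bound `v ≤ M · n ^ᴱ E` must be verified for every rational `p / q` in the cut `E`. Powers of
-- two make this linear: if `v` is at most a constant times `2 ^ e` and `2 ^ l ≤ n`, it suffices
-- that `e * q ≤ c * q + l * p`, where `c` costs only the constant factor `2 ^ c`. The obstacle is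
-- that λ is known only through approximations. For `L = approx ℓ n`, the fraction `suc L / n` is at
-- least λ and `pred L / n` at most λ. Taking `suc L` in the denominator of `j` errs towards small
-- groups, so the size bound loses nothing to rounding. The number of parts pays instead: the gap
-- between `suc L` and `pred L` is multiplied by `l ≤ n` and divided by at least `k * n`, which
-- leaves a constant in the exponent. The time exponent α′ must be one real number for all `n`, so
-- it is formed with a natural number Λ that is at least `suc L / n` for every `n ≥ 1`.

∣m-n∣≤o⇒m≤n+o : ∀ m n {o} → ∣ m - n ∣ ≤ o → m ≤ n + o
∣m-n∣≤o⇒m≤n+o m n {o} h = begin
  m                ≤⟨ m≤n+∣m-n∣ m n ⟩
  n + ∣ m - n ∣    ≤⟨ +-monoʳ-≤ n h ⟩
  n + o            ∎

∣m-n∣≤o⇒n≤m+o : ∀ m n {o} → ∣ m - n ∣ ≤ o → n ≤ m + o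
∣m-n∣≤o⇒n≤m+o m n h = ∣m-n∣≤o⇒m≤n+o n m (subst (_≤ _) (∣-∣-comm m n) h)

m≤n+o×n≤m+o⇒∣m-n∣≤o : ∀ {m n o} → m ≤ n + o → n ≤ m + o → ∣ m - n ∣ ≤ o
m≤n+o×n≤m+o⇒∣m-n∣≤o {m} {n} {o} h h′ with ≤-total m n
... | inj₁ m≤n = subst (_≤ o) (sym (m≤n⇒∣m-n∣≡n∸m m≤n)) (m≤n+o⇒m∸n≤o n m h′)
... | inj₂ n≤m = subst (_≤ o) (sym (trans (∣-∣-comm m n) (m≤n⇒∣m-n∣≡n∸m n≤m))) (m≤n+o⇒m∸n≤o m n h)

m<suc[m/n]*n : ∀ m n .{{_ : NonZero n}} → m < suc (m / n) * n
m<suc[m/n]*n m n = begin-strict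
  m                    ≡⟨ m≡m%n+[m/n]*n m n ⟩
  m % n + m / n * n    <⟨ +-monoˡ-< (m / n * n) (m%n<n m n) ⟩
  n + m / n * n        ∎

+m≤i⇒m≤∣i∣ : ∀ {m i} → + m ℤ.≤ i → m ≤ ℤ.∣ i ∣
+m≤i⇒m≤∣i∣ (ℤ.+≤+ h) = h

fraction : ∀ a b .{{_ : NonZero b}} → ℝ≥0
fraction a b .approx m = m * a / b
fraction a b .regular m n = m≤n+o×n≤m+o⇒∣m-n∣≤o
  (≤-trans (side m n) (+-monoʳ-≤ _ (m≤m+n m n)))
  (≤-trans (side n m) (+-monoʳ-≤ _ (m≤n+m n m)))
  where
  side : ∀ m n → n * (m * a / b) ≤ m * (n * a / b) + m
  side m n = *-cancelʳ-≤ _ _ b (begin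
    n * (m * a / b) * b             ≡⟨ *-assoc n _ b ⟩
    n * (m * a / b * b)             ≤⟨ *-monoʳ-≤ n (m/n*n≤m (m * a) b) ⟩
    n * (m * a)                     ≡⟨ swap n m a ⟩
    m * (n * a)                     ≤⟨ *-monoʳ-≤ m (<⇒≤ (m<suc[m/n]*n (n * a) b)) ⟩
    m * (suc (n * a / b) * b)       ≡⟨ assoc m (n * a / b) b ⟩
    (m * (n * a / b) + m) * b       ∎)
    where
    swap : ∀ n m a → n * (m * a) ≡ m * (n * a)
    swap = solve-∀
    assoc : ∀ m c b → m * (suc c * b) ≡ (m * c + m) * b
    assoc = solve-∀

fraction<fromℕ : ∀ a b k .{{_ : NonZero b}} → a < k * b → fraction a b <ʳ fromℕ k
-- The gap between `a / b` and `k` is at least `1 / b`, hence at least 3 after scaling by `3 * b`,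
-- while `_<ʳ_` asks for more than 2.
fraction<fromℕ a b k a<kb = 3 * b , *-cancelʳ-< b _ _ (begin-strict
  (3 * b * a / b + 2) * b          ≡⟨ *-distribʳ-+ b (3 * b * a / b) 2 ⟩
  3 * b * a / b * b + 2 * b        ≤⟨ +-monoˡ-≤ (2 * b) (m/n*n≤m (3 * b * a) b) ⟩
  3 * b * a + 2 * b                <⟨ +-monoʳ-< (3 * b * a) (*-monoˡ-< b (n<1+n 2)) ⟩
  3 * b * a + 3 * b                ≡⟨ expand a b ⟩
  3 * b * suc a                    ≤⟨ *-monoʳ-≤ (3 * b) a<kb ⟩
  3 * b * (k * b)                  ≡⟨ *-assoc (3 * b) k b ⟨
  3 * b * k * b                    ∎)
  where
  expand : ∀ a b → 3 * b * a + 3 * b ≡ 3 * b * suc a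
  expand = solve-∀

fraction-cut : ∀ a b .{{_ : NonZero b}} r → exponent (fraction a b) r →
               a * ↧ₙ r ≤ ℤ.∣ ↥ r ∣ * b
fraction-cut a b r@record{} (m , ℚ.*<* x<r) = *-cancelˡ-≤ (suc m) (begin
  suc m * (a * q)          ≡⟨ *-assoc (suc m) a q ⟨
  suc m * a * q            ≤⟨ *-monoˡ-≤ q (<⇒≤ (m<suc[m/n]*n (suc m * a) b)) ⟩
  suc c * b * q            ≡⟨ swap c b q ⟩
  (c + 1) * q * b          ≤⟨ *-monoˡ-≤ b bound ⟩
  p * suc m * b            ≡⟨ rotate p (suc m) b ⟩
  suc m * (p * b)          ∎)
  where
  p = ℤ.∣ ↥ r ∣
  q = ↧ₙ r
  c = suc m * a / b
  bound : (c + 1) * q ≤ p * suc m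
  bound = begin
    (c + 1) * q               ≤⟨ +m≤i⇒m≤∣i∣ (subst (ℤ._≤ _) (sym (ℤₚ.pos-* (c + 1) q)) (ℤₚ.<⇒≤ x<r)) ⟩
    ℤ.∣ ↥ r ℤ.* + suc m ∣     ≡⟨ ℤₚ.abs-* (↥ r) (+ suc m) ⟩
    p * suc m                 ∎
  swap : ∀ c b q → suc c * b * q ≡ (c + 1) * q * b
  swap = solve-∀
  rotate : ∀ p m b → p * m * b ≡ m * (p * b)
  rotate = solve-∀

-- A view that exposes the numerator as a natural number, so that after clearing denominators only
-- inequalities in `ℕ` remain.
data NonNegative : ℚᵘ → Set where
  ratio : ∀ a b → NonNegative (mkℚᵘ (+ a) b)

0≤⇒nonNegative : ∀ {r} → ℚ.0ℚᵘ ℚ.≤ r → NonNegative r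
0≤⇒nonNegative {mkℚᵘ (+ a) b} _ = ratio a b
0≤⇒nonNegative {mkℚᵘ -[1+ a ] b} (ℚ.*≤* ())

<ʳᵠ⇒nonNegative : ∀ x {r} → x <ʳᵠ r → NonNegative r
<ʳᵠ⇒nonNegative x {mkℚᵘ (+ a) b} _ = ratio a b
<ʳᵠ⇒nonNegative x {mkℚᵘ -[1+ a ] b} (m , ℚ.*<* h)
  with () ← subst (ℤ._< -[1+ a ] ℤ.* + suc m) (sym (ℤₚ.pos-* (approx x (suc m) + 1) (suc b))) h

<ʳᵠ-approx : ∀ x {a b} ((m , _) : x <ʳᵠ mkℚᵘ (+ a) b) → (approx x (suc m) + 1) * suc b < a * suc m
<ʳᵠ-approx x {a} {b} (m , ℚ.*<* h) =
  ℤₚ.drop‿+<+ (subst₂ ℤ._<_ (sym (ℤₚ.pos-* (approx x (suc m) + 1) (suc b))) (sym (ℤₚ.pos-* a (suc m))) h)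

<ᵠʳ-approx : ∀ x {a b} ((m , _) : mkℚᵘ (+ a) b <ᵠʳ x) → a * suc m + suc b ≤ approx x (suc m) * suc b
<ᵠʳ-approx x {a} {b} (m , ℚ.*<* h) = go (approx x (suc m)) h
  where
  go : ∀ y → + a ℤ.* + suc m ℤ.< (+ y ℤ.- + 1) ℤ.* + suc b → a * suc m + suc b ≤ y * suc b
  -- The subtraction of 1 is one of integers: at 0 it gives a negative number, which cannot exceed
  -- `a / suc b`.
  go zero h with () ← subst (ℤ._< ℤ.- + 1 ℤ.* + suc b) (sym (ℤₚ.pos-* a (suc m))) h
  go (suc y) h = begin
    a * suc m + suc b      ≤⟨ +-monoˡ-≤ (suc b) (<⇒≤ (ℤₚ.drop‿+<+
                                  (subst₂ ℤ._<_ (sym (ℤₚ.pos-* a (suc m))) (sym (ℤₚ.pos-* y (suc b))) h))) ⟩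
    y * suc b + suc b      ≡⟨ +-comm (y * suc b) (suc b) ⟩
    suc y * suc b          ∎

fromℕ<-ratio : ∀ {k a b} → fromℕ k <ʳᵠ mkℚᵘ (+ a) b → k * suc b < a
fromℕ<-ratio {k} {a} {b} h@(m , _) = *-cancelʳ-< (suc m) _ _ (begin-strict
  k * suc b * suc m              ≡⟨ swap k (suc b) (suc m) ⟩
  suc m * k * suc b              ≤⟨ *-monoˡ-≤ (suc b) (m≤m+n (suc m * k) 1) ⟩
  (suc m * k + 1) * suc b        <⟨ <ʳᵠ-approx (fromℕ k) h ⟩
  a * suc m                      ∎)
  where
  swap : ∀ k b m → k * b * m ≡ m * k * b
  swap = solve-∀

-- The left side is a natural number, so passing to `ℤ.∣ i ∣` is sound without knowing the sign of
-- `i`.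
abs-≤ : ∀ {x} i y {z} → + x ℤ.≤ i ℤ.* + y ℤ.* + z → x ≤ ℤ.∣ i ∣ * y * z
abs-≤ {x} i y {z} h = begin
  x                              ≤⟨ +m≤i⇒m≤∣i∣ h ⟩
  ℤ.∣ i ℤ.* + y ℤ.* + z ∣        ≡⟨ ℤₚ.abs-* (i ℤ.* + y) (+ z) ⟩
  ℤ.∣ i ℤ.* + y ∣ * z            ≡⟨ cong (_* z) (ℤₚ.abs-* i (+ y)) ⟩
  ℤ.∣ i ∣ * y * z                ∎

pos-cross : ∀ a b c d → + a ℤ.* + b ℤ.+ + c ℤ.* + d ≡ + (a * b + c * d)
pos-cross a b c d = sym (trans (ℤₚ.pos-+ (a * b) (c * d)) (cong₂ ℤ._+_ (ℤₚ.pos-* a b) (ℤₚ.pos-* c d)))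

≤*+-ratio : ∀ {a a′ b b′} r →
            mkℚᵘ (+ a) a′ ℚ.≤ r ℚ.* (mkℚᵘ (+ a) a′ ℚ.+ mkℚᵘ (+ b) b′) →
            a * ↧ₙ r * suc b′ ≤ ℤ.∣ ↥ r ∣ * (a * suc b′ + b * suc a′)
≤*+-ratio {a} {a′} {b} {b′} r@(mkℚᵘ i q) (ℚ.*≤* h) = *-cancelʳ-≤ _ _ (suc a′) (begin
  a * suc q * suc b′ * suc a′                  ≡⟨ swap a (suc q) (suc a′) (suc b′) ⟩
  a * (suc q * (suc a′ * suc b′))              ≤⟨ abs-≤ i _ (subst₂ ℤ._≤_
                                                    (sym (ℤₚ.pos-* a (suc q * (suc a′ * suc b′))))
                                                    (cong (λ z → i ℤ.* z ℤ.* + suc a′) (pos-cross a (suc b′) b (suc a′))) h) ⟩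
  ℤ.∣ i ∣ * (a * suc b′ + b * suc a′) * suc a′ ∎)
  where
  swap : ∀ a q c d → a * q * d * c ≡ a * (q * (c * d))
  swap = solve-∀

*≤*+-ratio : ∀ {a a′ b b′} r →
            mkℚᵘ (+ a) a′ ℚ.* mkℚᵘ (+ b) b′ ℚ.≤ r ℚ.* (mkℚᵘ (+ a) a′ ℚ.+ mkℚᵘ (+ b) b′) →
            a * b * ↧ₙ r ≤ ℤ.∣ ↥ r ∣ * (a * suc b′ + b * suc a′)
*≤*+-ratio {a} {a′} {b} {b′} r@(mkℚᵘ i q) (ℚ.*≤* h) = *-cancelʳ-≤ _ _ (suc a′ * suc b′) (begin
  a * b * suc q * (suc a′ * suc b′)            ≡⟨ *-assoc (a * b) (suc q) _ ⟩
  a * b * (suc q * (suc a′ * suc b′))          ≤⟨ abs-≤ i _ (subst₂ ℤ._≤_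
                                                    (trans (cong (ℤ._* + (suc q * (suc a′ * suc b′))) (sym (ℤₚ.pos-* a b)))
                                                           (sym (ℤₚ.pos-* (a * b) (suc q * (suc a′ * suc b′)))))
                                                    (cong (λ z → i ℤ.* z ℤ.* + (suc a′ * suc b′)) (pos-cross a (suc b′) b (suc a′))) h) ⟩
  ℤ.∣ i ∣ * (a * suc b′ + b * suc a′) * (suc a′ * suc b′) ∎)

-- The exponents of the claim evaluated at λ ≈ (approx λ n ± 1) / n, with
-- denominators cleared.

α/[α+β]-cut : ∀ k ℓ n r → α/[α+β] (fromℕ k) ℓ r →
              k * n * ↧ₙ r ≤ ℤ.∣ ↥ r ∣ * (k * n + suc (approx ℓ n))
α/[α+β]-cut k ℓ n r (a , b , k<a , 0≤b , b<ℓ , a≤) with <ʳᵠ⇒nonNegative (fromℕ k) k<a | 0≤⇒nonNegative 0≤b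
... | ratio a a′ | ratio b b′ = *-cancelʳ-≤ _ _ B (begin
  k * n * q * B                       ≡⟨ e₁ k n q B ⟩
  k * q * B * n                       ≤⟨ *-monoˡ-≤ n at-b ⟩
  p * (k * B + b) * n                 ≡⟨ e₂ p k B b n ⟩
  p * (k * n * B + n * b)             ≤⟨ *-monoʳ-≤ p (+-monoʳ-≤ (k * n * B) b≤) ⟩
  p * (k * n * B + suc (approx ℓ n) * B) ≡⟨ e₃ p (k * n) B (suc (approx ℓ n)) ⟩
  p * (k * n + suc (approx ℓ n)) * B  ∎)
  where
  p = ℤ.∣ ↥ r ∣
  q = ↧ₙ r
  A = suc a′
  B = suc b′
  m = proj₁ b<ℓ
  kA<a : k * A < a
  kA<a = fromℕ<-ratio {k} {a} {a′} k<a
  instance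
    _ : NonZero a
    _ = >-nonZero (m<n⇒0<n kA<a)
  -- The quotient `x / (x + y)` increases with `x`, so `a / A` may be lowered to `k`. Multiplying
  -- through by `a` avoids the division.
  at-b : k * q * B ≤ p * (k * B + b)
  at-b = *-cancelˡ-≤ a (begin
    a * (k * q * B)                   ≡⟨ e₁ a k q B ⟩
    k * (a * q * B)                   ≤⟨ *-monoʳ-≤ k (≤*+-ratio {a} {a′} {b} {b′} r a≤) ⟩
    k * (p * (a * B + b * A))         ≡⟨ e₂ k p a B b A ⟩
    p * (k * a * B + k * A * b)       ≤⟨ *-monoʳ-≤ p (+-monoʳ-≤ (k * a * B) (*-monoˡ-≤ b (<⇒≤ kA<a))) ⟩
    p * (k * a * B + a * b)           ≡⟨ e₃ p k a B b ⟩
    a * (p * (k * B + b))             ∎)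
    where
    e₁ : ∀ a k q B → a * (k * q * B) ≡ k * (a * q * B)
    e₁ = solve-∀
    e₂ : ∀ k p a B b A → k * (p * (a * B + b * A)) ≡ p * (k * a * B + k * A * b)
    e₂ = solve-∀
    e₃ : ∀ p k a B b → p * (k * a * B + a * b) ≡ a * (p * (k * B + b))
    e₃ = solve-∀
  -- The regularity error between indices `suc m` and `n` has two parts: `n * B` is cancelled by the
  -- margin built into `_<ᵠʳ_`, and `suc m` turns `approx ℓ n` into its successor.
  b≤ : n * b ≤ suc (approx ℓ n) * B
  b≤ = *-cancelʳ-≤ _ _ (suc m) (+-cancelʳ-≤ (n * B) _ _ (begin
    n * b * suc m + n * B                          ≡⟨ e₁ n b (suc m) B ⟩
    n * (b * suc m + B)                            ≤⟨ *-monoʳ-≤ n (<ᵠʳ-approx ℓ {b} {b′} b<ℓ) ⟩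
    n * (approx ℓ (suc m) * B)                     ≡⟨ *-assoc n _ B ⟨
    n * approx ℓ (suc m) * B                       ≤⟨ *-monoˡ-≤ B (∣m-n∣≤o⇒m≤n+o (n * approx ℓ (suc m)) (suc m * approx ℓ n)
                                                                                    (regular ℓ (suc m) n)) ⟩
    (suc m * approx ℓ n + (suc m + n)) * B         ≡⟨ e₂ (suc m) (approx ℓ n) n B ⟩
    suc (approx ℓ n) * B * suc m + n * B           ∎))
    where
    e₁ : ∀ n b m B → n * b * m + n * B ≡ n * (b * m + B)
    e₁ = solve-∀
    e₂ : ∀ m l n B → (m * l + (m + n)) * B ≡ suc l * B * m + n * B
    e₂ = solve-∀
  e₁ : ∀ k n q B → k * n * q * B ≡ k * q * B * n
  e₁ = solve-∀
  e₂ : ∀ p k B b n → p * (k * B + b) * n ≡ p * (k * n * B + n * b)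
  e₂ = solve-∀
  e₃ : ∀ p c B l → p * (c * B + l * B) ≡ p * (c + l) * B
  e₃ = solve-∀

αβ/[α+β]-cut : ∀ k ℓ n r → αβ/[α+β] (fromℕ k) ℓ r →
               k * pred (approx ℓ n) * ↧ₙ r ≤ ℤ.∣ ↥ r ∣ * (k * n + pred (approx ℓ n))
αβ/[α+β]-cut k ℓ n r (a , b , k<a , ℓ<b , ab≤) with <ʳᵠ⇒nonNegative (fromℕ k) k<a | <ʳᵠ⇒nonNegative ℓ ℓ<b
... | ratio a a′ | ratio b b′ = *-cancelʳ-≤ _ _ b (begin
  k * u * q * b                       ≡⟨ e₁ k u q b ⟩
  u * (k * b * q)                     ≤⟨ *-monoʳ-≤ u at-b ⟩
  u * (p * (k * B + b))               ≡⟨ e₂ u p k B b ⟩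
  p * (k * (u * B) + u * b)           ≤⟨ *-monoʳ-≤ p (+-monoˡ-≤ (u * b) (*-monoʳ-≤ k u≤)) ⟩
  p * (k * (n * b) + u * b)           ≡⟨ e₃ p k n b u ⟩
  p * (k * n + u) * b                 ∎)
  where
  p = ℤ.∣ ↥ r ∣
  q = ↧ₙ r
  A = suc a′
  B = suc b′
  m = proj₁ ℓ<b
  u = pred (approx ℓ n)
  kA<a : k * A < a
  kA<a = fromℕ<-ratio {k} {a} {a′} k<a
  b-bound : (approx ℓ (suc m) + 1) * B < b * suc m
  b-bound = <ʳᵠ-approx ℓ {b} {b′} ℓ<b
  instance
    _ : NonZero a
    _ = >-nonZero (m<n⇒0<n kA<a)
    _ : NonZero b
    _ = m*n≢0⇒m≢0 b {{>-nonZero (m<n⇒0<n b-bound)}}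
  at-b : k * b * q ≤ p * (k * B + b)
  at-b = *-cancelˡ-≤ a (begin
    a * (k * b * q)                   ≡⟨ e₁ a k b q ⟩
    k * (a * b * q)                   ≤⟨ *-monoʳ-≤ k (*≤*+-ratio {a} {a′} {b} {b′} r ab≤) ⟩
    k * (p * (a * B + b * A))         ≡⟨ e₂ k p a B b A ⟩
    p * (k * a * B + k * A * b)       ≤⟨ *-monoʳ-≤ p (+-monoʳ-≤ (k * a * B) (*-monoˡ-≤ b (<⇒≤ kA<a))) ⟩
    p * (k * a * B + a * b)           ≡⟨ e₃ p k a B b ⟩
    a * (p * (k * B + b))             ∎)
    where
    e₁ : ∀ a k b q → a * (k * b * q) ≡ k * (a * b * q)
    e₁ = solve-∀
    e₂ : ∀ k p a B b A → k * (p * (a * B + b * A)) ≡ p * (k * a * B + k * A * b)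
    e₂ = solve-∀
    e₃ : ∀ p k a B b → p * (k * a * B + a * b) ≡ a * (p * (k * B + b))
    e₃ = solve-∀
  -- Of the regularity error `suc m + n`, the `pred` absorbs `suc m` and the added 1 absorbs `n`.
  suc[m]*u≤ : suc m * u ≤ n * (approx ℓ (suc m) + 1)
  suc[m]*u≤ = drop (approx ℓ n) (∣m-n∣≤o⇒n≤m+o _ _ (regular ℓ (suc m) n))
    where
    e : ∀ n l m → n * l + (m + n) ≡ m + n * (l + 1)
    e = solve-∀
    drop : ∀ y → suc m * y ≤ n * approx ℓ (suc m) + (suc m + n) →
           suc m * pred y ≤ n * (approx ℓ (suc m) + 1)
    drop zero    _ = ≤-trans (≤-reflexive (*-zeroʳ (suc m))) z≤n
    drop (suc y) h = +-cancelˡ-≤ (suc m) _ _ (begin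
      suc m + suc m * y                        ≡⟨ *-suc (suc m) y ⟨
      suc m * suc y                            ≤⟨ h ⟩
      n * approx ℓ (suc m) + (suc m + n)       ≡⟨ e n (approx ℓ (suc m)) (suc m) ⟩
      suc m + n * (approx ℓ (suc m) + 1)       ∎)
  u≤ : u * B ≤ n * b
  u≤ = *-cancelˡ-≤ (suc m) (begin
    suc m * (u * B)                                ≡⟨ *-assoc (suc m) u B ⟨
    suc m * u * B                                  ≤⟨ *-monoˡ-≤ B suc[m]*u≤ ⟩
    n * (approx ℓ (suc m) + 1) * B                 ≡⟨ *-assoc n _ B ⟩
    n * ((approx ℓ (suc m) + 1) * B)               ≤⟨ *-monoʳ-≤ n (<⇒≤ b-bound) ⟩
    n * (b * suc m)                                ≡⟨ e n b (suc m) ⟩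
    suc m * (n * b)                                ∎)
    where
    e : ∀ n b m → n * (b * m) ≡ m * (n * b)
    e = solve-∀
  e₁ : ∀ k u q b → k * u * q * b ≡ u * (k * b * q)
  e₁ = solve-∀
  e₂ : ∀ u p k B b → u * (p * (k * B + b)) ≡ p * (k * (u * B) + u * b)
  e₂ = solve-∀
  e₃ : ∀ p k n b u → p * (k * (n * b) + u * b) ≡ p * (k * n + u) * b
  e₃ = solve-∀

-- (2 + x) / (k + x) increases with x, here taken from suc L / n to Λ.

time-cut : ∀ k Λ n L p q → suc L ≤ n * Λ → (2 + k) * (2 + Λ) * q ≤ p * (2 + k + Λ) →
           (2 + k) * (2 * n + suc L) * q ≤ p * ((2 + k) * n + suc L)
time-cut k Λ n L p q L<nΛ h = *-cancelʳ-≤ _ _ (2 + k + Λ) (begin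
  (2 + k) * (2 * n + v) * q * (2 + k + Λ)        ≡⟨ e₁ (2 + k) (2 * n + v) q (2 + k + Λ) ⟩
  (2 + k) * q * ((2 * n + v) * (2 + k + Λ))      ≤⟨ *-monoʳ-≤ ((2 + k) * q) mediant ⟩
  (2 + k) * q * ((2 + Λ) * ((2 + k) * n + v))    ≡⟨ e₂ (2 + k) q (2 + Λ) ((2 + k) * n + v) ⟩
  (2 + k) * (2 + Λ) * q * ((2 + k) * n + v)      ≤⟨ *-monoˡ-≤ ((2 + k) * n + v) h ⟩
  p * (2 + k + Λ) * ((2 + k) * n + v)            ≡⟨ e₃ p (2 + k + Λ) ((2 + k) * n + v) ⟩
  p * ((2 + k) * n + v) * (2 + k + Λ)            ∎)
  where
  v = suc L
  -- Both sides agree except for `k * v` on the left against `k * (n * Λ)` on the right.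
  mediant : (2 * n + v) * (2 + k + Λ) ≤ (2 + Λ) * ((2 + k) * n + v)
  mediant = begin
    (2 * n + v) * (2 + k + Λ)                    ≡⟨ d₁ n v k Λ ⟩
    k * v + (2 * n + v) * (2 + Λ) + 2 * k * n    ≤⟨ +-monoˡ-≤ (2 * k * n) (+-monoˡ-≤ _ (*-monoʳ-≤ k L<nΛ)) ⟩
    k * (n * Λ) + (2 * n + v) * (2 + Λ) + 2 * k * n ≡⟨ d₂ n v k Λ ⟩
    (2 + Λ) * ((2 + k) * n + v)                  ∎
    where
    d₁ : ∀ n v k Λ → (2 * n + v) * (2 + k + Λ) ≡ k * v + (2 * n + v) * (2 + Λ) + 2 * k * n
    d₁ = solve-∀
    d₂ : ∀ n v k Λ → k * (n * Λ) + (2 * n + v) * (2 + Λ) + 2 * k * n ≡ (2 + Λ) * ((2 + k) * n + v)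
    d₂ = solve-∀
  e₁ : ∀ k a q b → k * a * q * b ≡ k * q * (a * b)
  e₁ = solve-∀
  e₂ : ∀ k q a b → k * q * (a * b) ≡ k * a * q * b
  e₂ = solve-∀
  e₃ : ∀ p a b → p * a * b ≡ p * b * a
  e₃ = solve-∀

-- Makes `3 + approx ℓ 1` a bound on the estimate `suc (approx ℓ n) / n` used by the program,
-- uniformly in `n`. Regularity against index 1 costs `n + 1`, the successor costs 1 more, and
-- `n + 2 ≤ 3 * n`.
approx-linear : ∀ ℓ n → 1 ≤ n → suc (approx ℓ n) ≤ n * (3 + approx ℓ 1)
approx-linear ℓ n 1≤n = begin
  suc (approx ℓ n)                      ≡⟨ cong suc (*-identityˡ (approx ℓ n)) ⟨
  suc (1 * approx ℓ n)                  ≤⟨ s≤s (∣m-n∣≤o⇒m≤n+o _ _ (regular ℓ n 1)) ⟩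
  suc (n * approx ℓ 1 + (n + 1))        ≡⟨ e₁ n (approx ℓ 1) ⟩
  n * approx ℓ 1 + n + 2 * 1            ≤⟨ +-monoʳ-≤ (n * approx ℓ 1 + n) (*-monoʳ-≤ 2 1≤n) ⟩
  n * approx ℓ 1 + n + 2 * n            ≡⟨ e₂ n (approx ℓ 1) ⟩
  n * (3 + approx ℓ 1)                  ∎
  where
  e₁ : ∀ n a → suc (n * a + (n + 1)) ≡ n * a + n + 2 * 1
  e₁ = solve-∀
  e₂ : ∀ n a → n * a + n + 2 * n ≡ n * (3 + a)
  e₂ = solve-∀

-- Below, j = ⌊ l k n / d ⌋ with d = k n + suc L, and i = l - j.

size-exponent : ∀ k n L l j p q (let d = k * n + suc L) .{{_ : NonZero d}} →
                j * d ≤ l * (k * n) → k * n * q ≤ p * d →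
                j * q ≤ 0 * q + l * p
size-exponent k n L l j p q j≤ h = *-cancelʳ-≤ _ _ d (begin
  j * q * d             ≡⟨ e₁ j q d ⟩
  j * d * q             ≤⟨ *-monoˡ-≤ q j≤ ⟩
  l * (k * n) * q       ≡⟨ *-assoc l (k * n) q ⟩
  l * (k * n * q)       ≤⟨ *-monoʳ-≤ l h ⟩
  l * (p * d)           ≡⟨ *-assoc l p d ⟨
  l * p * d             ∎)
  where
  d = k * n + suc L
  e₁ : ∀ j q d → j * q * d ≡ j * d * q
  e₁ = solve-∀

-- Rounding `j` down raises `i` by at most 1 above `l * suc L / d`; this is the summand `d`.
i*d≤ : ∀ k n L l i j (let d = k * n + suc L) → i + j ≡ l → l * (k * n) < suc j * d → i * d ≤ l * suc L + d
i*d≤ k n L l i j refl <j = +-cancelʳ-≤ (l * (k * n)) _ _ (begin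
  i * d + l * (k * n)                  ≤⟨ +-monoʳ-≤ (i * d) (<⇒≤ <j) ⟩
  i * d + suc j * d                    ≡⟨ e i j (k * n) (suc L) ⟩
  l * suc L + d + l * (k * n)          ∎)
  where
  d = k * n + suc L
  e : ∀ i j c v → i * (c + v) + suc j * (c + v) ≡ (i + j) * v + (c + v) + (i + j) * c
  e = solve-∀

-- In the constant `2 + k`, the `k` comes from rounding `j`, multiplied by `k`. The 2 comes from
-- `suc L ≤ pred L + 2`: the excess `2 * (k * l) / d` is at most 2, as `l ≤ n`.
count-exponent : ∀ k n L l i j p q (let d = k * n + suc L) .{{_ : NonZero d}} →
                 l ≤ n → i + j ≡ l → l * (k * n) < suc j * d →
                 k * pred L * q ≤ p * (k * n + pred L) →
                 k * i * q ≤ (2 + k) * q + l * p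
count-exponent k n L l i j p q l≤n i+j≡l <j h = *-cancelʳ-≤ _ _ d (begin
  k * i * q * d                                ≡⟨ e₁ k i q d ⟩
  k * q * (i * d)                              ≤⟨ *-monoʳ-≤ (k * q) (i*d≤ k n L l i j i+j≡l <j) ⟩
  k * q * (l * suc L + d)                      ≤⟨ *-monoʳ-≤ (k * q) (+-monoˡ-≤ d (*-monoʳ-≤ l suc[L]≤)) ⟩
  k * q * (l * (u + 2) + d)                    ≡⟨ e₂ k q l u d ⟩
  l * (k * u * q) + 2 * q * (k * l) + k * q * d
    ≤⟨ +-monoˡ-≤ (k * q * d) (+-mono-≤ (*-monoʳ-≤ l h) (*-monoʳ-≤ (2 * q) (*-monoʳ-≤ k l≤n))) ⟩
  l * (p * (k * n + u)) + 2 * q * (k * n) + k * q * d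
    ≤⟨ +-monoˡ-≤ (k * q * d) (+-mono-≤ (*-monoʳ-≤ l (*-monoʳ-≤ p (+-monoʳ-≤ (k * n) u≤)))
                                       (*-monoʳ-≤ (2 * q) (m≤m+n (k * n) (suc L)))) ⟩
  l * (p * d) + 2 * q * d + k * q * d          ≡⟨ e₃ l p d q k ⟩
  ((2 + k) * q + l * p) * d                    ∎)
  where
  d = k * n + suc L
  u = pred L
  u≤ : u ≤ suc L
  u≤ = m≤n⇒m≤1+n pred[n]≤n
  suc[L]≤ : suc L ≤ u + 2
  suc[L]≤ = ≤-trans (s≤s (suc-pred≤ L)) (≤-reflexive (+-comm 2 u))
    where
    suc-pred≤ : ∀ m → m ≤ suc (pred m)
    suc-pred≤ zero    = z≤n
    suc-pred≤ (suc m) = ≤-refl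
  e₁ : ∀ k i q d → k * i * q * d ≡ k * q * (i * d)
  e₁ = solve-∀
  e₂ : ∀ k q l u d → k * q * (l * (u + 2) + d) ≡ l * (k * u * q) + 2 * q * (k * l) + k * q * d
  e₂ = solve-∀
  e₃ : ∀ l p d q k → l * (p * d) + 2 * q * d + k * q * d ≡ ((2 + k) * q + l * p) * d
  e₃ = solve-∀

-- The clique size is `2 + k` here. Since `i + j ≡ l`, the exponent `(2 + k) * i + 2 * j` equals
-- `2 * l + k * i`, so only `k * i` suffers from rounding and the constant is `k`.
time-exponent : ∀ k n L l i j p q → .{{_ : NonZero ((2 + k) * n + suc L)}} →
                i + j ≡ l → l * ((2 + k) * n) < suc j * ((2 + k) * n + suc L) →
                (2 + k) * (2 * n + suc L) * q ≤ p * ((2 + k) * n + suc L) →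
                ((2 + k) * i + 2 * j) * q ≤ k * q + l * p
time-exponent k n L l i j p q refl <j h = *-cancelʳ-≤ _ _ d (begin
  ((2 + k) * i + 2 * j) * q * d                  ≡⟨ e₁ k i j q d ⟩
  2 * l * q * d + k * q * (i * d)                ≤⟨ +-monoʳ-≤ (2 * l * q * d) (*-monoʳ-≤ (k * q) (i*d≤ (2 + k) n L l i j refl <j)) ⟩
  2 * l * q * d + k * q * (l * suc L + d)        ≡⟨ e₂ k n (suc L) l q ⟩
  l * ((2 + k) * (2 * n + suc L) * q) + k * q * d ≤⟨ +-monoˡ-≤ (k * q * d) (*-monoʳ-≤ l h) ⟩
  l * (p * d) + k * q * d                        ≡⟨ e₃ l p d k q ⟩
  (k * q + l * p) * d                            ∎)
  where
  d = (2 + k) * n + suc L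
  e₁ : ∀ k i j q d → ((2 + k) * i + 2 * j) * q * d ≡ 2 * (i + j) * q * d + k * q * (i * d)
  e₁ = solve-∀
  e₂ : ∀ k n v l q → 2 * l * q * ((2 + k) * n + v) + k * q * (l * v + ((2 + k) * n + v))
                   ≡ l * ((2 + k) * (2 * n + v) * q) + k * q * ((2 + k) * n + v)
  e₂ = solve-∀
  e₃ : ∀ l p d k q → l * (p * d) + k * q * d ≡ (k * q + l * p) * d
  e₃ = solve-∀

-- From exponents of two to powers of `n`

^-distribʳ-* : ∀ o m n → (m * n) ^ o ≡ m ^ o * n ^ o
^-distribʳ-* zero    m n = refl
^-distribʳ-* (suc o) m n = trans (cong (m * n *_) (^-distribʳ-* o m n)) (swap m n (m ^ o) (n ^ o))
  where
  swap : ∀ m n a b → m * n * (a * b) ≡ m * a * (n * b)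
  swap = solve-∀

-- Raising `v ≤ C * 2 ^ e` to the power `q` leaves a comparison of exponents of two; `2 ^ (l * p)`
-- is then at most `n ^ p`.
^ᴱ-bound : ∀ {n v} E l C c e → 2 ^ l ≤ n → v ≤ C * 2 ^ e →
           (∀ r → E r → e * ↧ₙ r ≤ c * ↧ₙ r + l * ℤ.∣ ↥ r ∣) → v ≤ C * 2 ^ c · n ^ᴱ E
^ᴱ-bound {n} {v} E l C c e 2^l≤n v≤ exponent≤ r cut = begin
  v ^ q                                  ≤⟨ ^-monoˡ-≤ q v≤ ⟩
  (C * 2 ^ e) ^ q                        ≡⟨ ^-distribʳ-* q C (2 ^ e) ⟩
  C ^ q * (2 ^ e) ^ q                    ≡⟨ cong (C ^ q *_) (^-*-assoc 2 e q) ⟩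
  C ^ q * 2 ^ (e * q)                    ≤⟨ *-monoʳ-≤ (C ^ q) (^-monoʳ-≤ 2 (exponent≤ r cut)) ⟩
  C ^ q * 2 ^ (c * q + l * p)            ≡⟨ cong (C ^ q *_) (^-distribˡ-+-* 2 (c * q) (l * p)) ⟩
  C ^ q * (2 ^ (c * q) * 2 ^ (l * p))    ≡⟨ *-assoc (C ^ q) _ _ ⟨
  C ^ q * 2 ^ (c * q) * 2 ^ (l * p)      ≡⟨ cong₂ _*_ (trans (cong (C ^ q *_) (sym (^-*-assoc 2 c q)))
                                                                (sym (^-distribʳ-* q C (2 ^ c))))
                                                         (sym (^-*-assoc 2 l p)) ⟩
  (C * 2 ^ c) ^ q * (2 ^ l) ^ p          ≤⟨ *-monoʳ-≤ ((C * 2 ^ c) ^ q) (^-monoˡ-≤ p 2^l≤n) ⟩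
  (C * 2 ^ c) ^ q * n ^ p                ∎
  where
  p = ℤ.∣ ↥ r ∣
  q = ↧ₙ r

-- Programs

Registers : Set
Registers = ℕ → ℕ

update-same : ∀ (ρ : Registers) i v → (ρ [ i ↦ v ]) i ≡ v
update-same ρ i v with i ≡ᵇ i | ≡⇒≡ᵇ i i refl
... | true | _ = refl

less-true : ∀ {a b} → a < b → ⟦ less ⟧ᵒ a b ≡ 1
less-true {a} {b} a<b with a <ᵇ b | <⇒<ᵇ a<b
... | true | _ = refl

less-false : ∀ {a b} → b ≤ a → ⟦ less ⟧ᵒ a b ≡ 0
less-false {a} {b} b≤a with a <ᵇ b in eq
... | false = refl
... | true  = contradiction b≤a (<⇒≱ (<ᵇ⇒< a b (subst T (sym eq) tt)))

concat-silent : ∀ d → concat {A = ℕ} (applyUpTo (λ _ → []) d) ≡ []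
concat-silent zero    = refl
concat-silent (suc d) = concat-silent d

forLoop : ℕ → ℕ → Program → Program
forLoop i b body =
  set i (lit 0) ⨟ while (op less (reg i) (reg b)) (body ⨟ set i (op plus (reg i) (lit 1)))

-- Hoare triples with output and running time

module Triples (ℓ : ℝ≥0) (bound : ℕ) (mem : ℕ → ℕ) where

  open Semantics ℓ bound

  -- Only programs that leave the memory unchanged occur.

  record Outcome (P : Program) (ρ : Registers) (ws : List ℕ) (τ : ℕ) (Q : Registers → Set) : Set where
    constructor outcome
    field
      {final} : Registers
      {steps} : ℕ
      exec    : Exec P ⟨ ρ , mem ⟩ ⟨ final , mem ⟩ ws steps
      steps≤  : steps ≤ τ
      holds   : Q final

  private variable
    P P′  : Program
    ρ     : Registers
    ws ws′ : List ℕ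
    τ τ′ v i b N : ℕ
    e     : Expr
    Q Q′  : Registers → Set

  printing : ws ≡ ws′ → Outcome P ρ ws τ Q → Outcome P ρ ws′ τ Q
  printing refl o = o

  ensuring : (∀ {ρ′} → Q ρ′ → Q′ ρ′) → Outcome P ρ ws τ Q → Outcome P ρ ws τ Q′
  ensuring f (outcome x t q) = outcome x t (f q)

  within : τ ≤ τ′ → Outcome P ρ ws τ Q → Outcome P ρ ws τ′ Q
  within τ≤τ′ (outcome x t q) = outcome x (≤-trans t τ≤τ′) q

  infixr 4 _then_

  _then_ : Outcome P ρ ws τ Q → (∀ {ρ′} → Q ρ′ → Outcome P′ ρ′ ws′ τ′ Q′) →
           Outcome (P ⨟ P′) ρ (ws ++ ws′) (τ + τ′) Q′
  outcome x t q then o with outcome x′ t′ q′ ← o q = outcome (seq x x′) (+-mono-≤ t t′) q′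

  skip-outcome : Q ρ → Outcome skip ρ [] 1 Q
  skip-outcome q = outcome skip ≤-refl q

  set-outcome : ⟦ e ⟧ ⟨ ρ , mem ⟩ ≡ v → v < bound → Q (ρ [ i ↦ v ]) →
                Outcome (set i e) ρ [] (suc (size e)) Q
  set-outcome refl v<bound q = outcome (set v<bound) ≤-refl q

  print-outcome : ⟦ e ⟧ ⟨ ρ , mem ⟩ ≡ v → v < bound → Q ρ →
                  Outcome (print e) ρ (v ∷ []) (suc (size e)) Q
  print-outcome refl v<bound q = outcome (print v<bound) ≤-refl q

  -- The intermediate postcondition pins down the register file exactly, so that later lookups at
  -- literal register numbers reduce by computation.
  set-then : ⟦ e ⟧ ⟨ ρ , mem ⟩ ≡ v → v < bound → Outcome P (ρ [ i ↦ v ]) ws τ Q →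
             Outcome (set i e ⨟ P) ρ ws (suc (size e) + τ) Q
  set-then {ρ = ρ} {v = v} {i = i} eq v<bound o = set-outcome {Q = _≡ ρ [ i ↦ v ]} eq v<bound refl then λ { refl → o }

  ifnz-outcome : ∀ c → ⟦ e ⟧ ⟨ ρ , mem ⟩ ≡ (if c then 1 else 0) →
                 (c ≡ true → Outcome P ρ ws τ Q) → (c ≡ false → Outcome P′ ρ ws τ Q) →
                 Outcome (ifnz e P P′) ρ ws (suc (size e + τ)) Q
  ifnz-outcome {e = e} true  eq o _ with outcome x t q ← o refl =
    outcome (if-then (λ eq′ → 1+n≢0 (trans (sym eq) eq′)) x) (s≤s (+-monoʳ-≤ (size e) t)) q
  ifnz-outcome {e = e} false eq _ o with outcome x t q ← o refl =
    outcome (if-else eq x) (s≤s (+-monoʳ-≤ (size e) t)) q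

  then-outcome : ⟦ e ⟧ ⟨ ρ , mem ⟩ ≢ 0 → Outcome P ρ ws τ Q →
                 Outcome (ifnz e P P′) ρ ws (suc (size e + τ)) Q
  then-outcome {e = e} ≢0 (outcome x t q) = outcome (if-then ≢0 x) (s≤s (+-monoʳ-≤ (size e) t)) q

  -- Induction on the number `d` of remaining passes: `Inv` and `ws` are indexed from the current
  -- pass and shifted by `suc`, which is why the counter starts at an arbitrary `x`. The third
  -- implication says that `Inv` survives writes to the counter. Each pass adds 4 for the test and 4
  -- for the increment.
  while-outcome : ∀ {body} (ws : ℕ → List ℕ) (Inv : ℕ → Registers → Set) d x →
    x + d ≡ N → N < bound →
    (∀ {y ρ} → Inv y ρ → ρ b ≡ N) →
    (∀ {y ρ v} → Inv y ρ → Inv y (ρ [ i ↦ v ])) →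
    (∀ {y ρ} → y < d → ρ i ≡ x + y → Inv y ρ →
      Outcome body ρ (ws y) τ (λ ρ′ → ρ′ i ≡ x + y × Inv (suc y) ρ′)) →
    ρ i ≡ x → Inv 0 ρ →
    Outcome (while (op less (reg i) (reg b)) (body ⨟ set i (op plus (reg i) (lit 1))))
            ρ (concat (applyUpTo ws d)) (4 + d * (8 + τ)) (Inv d)
  while-outcome {N = N} {b = b} {i = i} {ρ = ρ} ws Inv zero x x+0≡N N<bound limit _ _ ρi inv =
    outcome (stop (less-false (≤-reflexive ρb≡ρi))) (m≤m+n 4 0) inv
    where
    ρb≡ρi : ρ b ≡ ρ i
    ρb≡ρi = trans (limit inv) (trans (sym x+0≡N) (trans (+-identityʳ x) (sym ρi)))
  while-outcome {N = N} {b = b} {i = i} {τ = τ} {ρ = ρ} ws Inv (suc d) x x+d≡N N<bound limit frame step ρi inv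
    with outcome {ρ′} {t} exec t≤ (ρ′i , inv′) ← step z<s (trans ρi (sym (+-identityʳ x))) inv
    = go (while-outcome (ws ∘ suc) (Inv ∘ suc) d (suc x)
           (trans (sym (+-suc x d)) x+d≡N) N<bound limit frame
           (λ {y} y<d ρi inv → ensuring (λ (ρ′i , inv) → trans ρ′i (+-suc x y) , inv)
                                        (step (s<s y<d) (trans ρi (sym (+-suc x y))) inv))
           (trans (update-same ρ′ i _) ρ′i+1) (frame inv′))
    where
    ρ′i+1 : ρ′ i + 1 ≡ suc x
    ρ′i+1 = trans (+-comm (ρ′ i) 1) (cong suc (trans ρ′i (+-identityʳ x)))
    1+x≤N : suc x ≤ N
    1+x≤N = subst (suc x ≤_) (trans (sym (+-suc x d)) x+d≡N) (m≤m+n (suc x) d)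
    test : ⟦ less ⟧ᵒ (ρ i) (ρ b) ≡ 1
    test = less-true (subst₂ _<_ (sym ρi) (sym (limit inv)) 1+x≤N)
    go : Outcome _ (ρ′ [ i ↦ ρ′ i + 1 ]) (concat (applyUpTo (ws ∘ suc) d)) (4 + d * (8 + τ)) (Inv (suc d)) →
         Outcome _ ρ (concat (applyUpTo ws (suc d))) (4 + suc d * (8 + τ)) (Inv (suc d))
    go (outcome {_} {t′} exec′ t′≤ holds) = printing (cong (_++ concat (applyUpTo (ws ∘ suc) d)) (++-identityʳ (ws 0)))
      (outcome (loop (λ eq → 1+n≢0 (trans (sym test) eq))
                     (seq exec (set (subst (_< bound) (sym ρ′i+1) (≤-<-trans 1+x≤N N<bound)))) exec′)
               (begin
                 4 + (t + 4 + t′)                  ≤⟨ +-monoʳ-≤ 4 (+-mono-≤ (+-monoˡ-≤ 4 t≤) t′≤) ⟩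
                 4 + (τ + 4 + (4 + d * (8 + τ)))   ≡⟨ cost τ d ⟩
                 4 + suc d * (8 + τ)               ∎)
               holds)
      where
      cost : ∀ τ d → 4 + (τ + 4 + (4 + d * (8 + τ))) ≡ 4 + suc d * (8 + τ)
      cost = solve-∀

  forLoop-outcome : ∀ {body} (ws : ℕ → List ℕ) (Inv : ℕ → Registers → Set) → N < bound →
    (∀ {x ρ} → Inv x ρ → ρ b ≡ N) →
    (∀ {x ρ v} → Inv x ρ → Inv x (ρ [ i ↦ v ])) →
    (∀ {x ρ} → x < N → ρ i ≡ x → Inv x ρ →
      Outcome body ρ (ws x) τ (λ ρ′ → ρ′ i ≡ x × Inv (suc x) ρ′)) →
    Inv 0 ρ →
    Outcome (forLoop i b body) ρ (concat (applyUpTo ws N)) (6 + N * (8 + τ)) (Inv N)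
  forLoop-outcome {N = N} {i = i} {ρ = ρ} ws Inv N<bound limit frame step inv =
    set-then refl (≤-<-trans z≤n N<bound)
      (while-outcome ws Inv N 0 refl N<bound limit frame step (update-same ρ i 0) (frame inv))

-- ⌊log₂ n⌋ for n ≥ 1, when i = n.

doublings : ℕ → ℕ → ℕ
doublings n zero    = 0
doublings n (suc i) = if n <ᵇ 2 * 2 ^ doublings n i then doublings n i else suc (doublings n i)

doublings≤ : ∀ n i → doublings n i ≤ i
doublings≤ n zero = z≤n
doublings≤ n (suc i) with n <ᵇ 2 * 2 ^ doublings n i
... | true  = m≤n⇒m≤1+n (doublings≤ n i)
... | false = s≤s (doublings≤ n i)

2^doublings≤ : ∀ n i → 1 ≤ n → 2 ^ doublings n i ≤ n
2^doublings≤ n zero    1≤n = 1≤n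
2^doublings≤ n (suc i) 1≤n with n <ᵇ 2 * 2 ^ doublings n i in eq
... | true  = 2^doublings≤ n i 1≤n
... | false = ≮⇒≥ (λ n< → subst T eq (<⇒<ᵇ n<))

n<2^n : ∀ n → n < 2 ^ n
n<2^n zero    = s≤s z≤n
n<2^n (suc n) = +-mono-≤ (m^n>0 2 n) (≤-trans (n<2^n n) (m≤m+n (2 ^ n) 0))

-- Once a doubling is refused, `n` is below the next power and all later doublings are refused too.
-- Otherwise every pass has doubled, and after `n` passes `n < 2 ^ n` decides.
<2^doublings : ∀ n i → n < 2 * 2 ^ doublings n i ⊎ doublings n i ≡ i
<2^doublings n zero = inj₂ refl
<2^doublings n (suc i) with n <ᵇ 2 * 2 ^ doublings n i in eq | <2^doublings n i
... | true  | _        = inj₁ (<ᵇ⇒< n _ (subst T (sym eq) tt))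
... | false | inj₂ eq′ = inj₂ (cong suc eq′)
... | false | inj₁ n<  = contradiction (<⇒<ᵇ n<) (subst (λ b → ¬ T b) (sym eq) id)

n<2*2^log : ∀ n → n < 2 * 2 ^ doublings n n
n<2*2^log n with <2^doublings n n
... | inj₁ n< = n<
... | inj₂ eq = ≤-trans (subst (λ z → n < 2 ^ z) (sym eq) (n<2^n n)) (m≤n*m (2 ^ doublings n n) 2)

-- Vertex p of part T of k copies of groups of s vertices; the base-g digits
-- of T say which group is copied where.

vertexAt : (s g k T p : ℕ) → ℕ
vertexAt s g zero    T p = 0
vertexAt s g (suc k) T p =
  ⟦ less ⟧ᵒ p s * (⟦ mod ⟧ᵒ T g * s + p) +
  (1 ∸ ⟦ less ⟧ᵒ p s) * vertexAt s g k (⟦ div ⟧ᵒ T g) (p ∸ s)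

-- Expressions have no conditional, so the two cases are multiplied by the 0-1 value of `less` and
-- by its complement. The recursion is unrolled, and the size depends on `k` only.
vertexE : ℕ → Expr → Expr → Expr
vertexE zero    eT ep = lit 0
vertexE (suc k) eT ep =
  op plus (op times (op less ep (reg 4)) (op plus (op times (op mod eT (reg 5)) (reg 4)) ep))
          (op times (op monus (lit 1) (op less ep (reg 4)))
                    (vertexE k (op div eT (reg 5)) (op monus ep (reg 4))))

powerE : ℕ → Expr
powerE zero    = lit 1
powerE (suc k) = op times (reg 5) (powerE k)

-- The groups cover `2 * 2 ^ l` positions, which may exceed `n`. Reduction modulo `n` sends the
-- surplus to existing vertices, which a pullback tolerates. The leading 1 skips the cell that holds
-- `n`.
entryE : ℕ → Expr
entryE k = load (op plus (lit 1) (op plus (op times (u 9) (reg 0)) (u 10)))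
  where
  u : ℕ → Expr
  u i = op mod (vertexE k (reg 8) (reg i)) (reg 0)

-- This is `l * k / (k + λ)` expanded by `n`: the query at `n` returns `n * λ` up to 1, and adding 1
-- gives an upper estimate.
groupLogE : ℕ → Expr
groupLogE k = op div (op times (reg 2) kn) (op plus kn (op plus (lit 1) (query (reg 0))))
  where
  kn = op times (lit k) (reg 0)

-- Registers: 0 holds n, 1 and 2 hold 2 ^ ⌊log₂ n⌋ and ⌊log₂ n⌋, 3 the logarithm of
-- the group size, 4 the group size, 5 the number of groups, 6 the number of
-- vertices of a part, 7 the number of parts, and 8, 9, 10 count.

decompose : ℕ → Program
decompose k =
  set 0 (load (lit 0)) ⨟
  ifnz (reg 0)
    ( set 1 (lit 1) ⨟ set 2 (lit 0) ⨟
      -- There are `n` passes although about `log n` doublings happen; linear time is dominated by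
      -- the output.
      forLoop 9 0 (ifnz (op less (reg 0) (op times (lit 2) (reg 1)))
                        skip
                        (set 1 (op times (lit 2) (reg 1)) ⨟ set 2 (op plus (lit 1) (reg 2)))) ⨟
      set 3 (groupLogE k) ⨟ set 4 (lit 1) ⨟
      forLoop 9 3 (set 4 (op times (lit 2) (reg 4))) ⨟
      set 5 (op div (op times (lit 2) (reg 1)) (reg 4)) ⨟
      set 6 (op times (lit k) (reg 4)) ⨟
      set 7 (powerE k) ⨟
      print (reg 7) ⨟
      forLoop 8 7 (print (reg 6) ⨟ forLoop 9 6 (forLoop 10 6 (print (entryE k)))) )
    (print (lit 0))

module _ (k n L : ℕ) where

  logSize groupLog groupSize groupCount partSize partCount : ℕ
  logSize    = doublings n n
  groupLog   = ⟦ div ⟧ᵒ (logSize * (k * n)) (k * n + suc L)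
  groupSize  = 2 ^ groupLog
  groupCount = ⟦ div ⟧ᵒ (2 * 2 ^ logSize) groupSize
  partSize   = k * groupSize
  partCount  = groupCount ^ k

  vertexOf : ℕ → ℕ → ℕ
  vertexOf T p = ⟦ mod ⟧ᵒ (vertexAt groupSize groupCount k T p) n

  module _ (mem : ℕ → ℕ) where

    entryWord : (T p q : ℕ) → ℕ
    entryWord T p q = mem (1 + (vertexOf T p * n + vertexOf T q))

    rowWords : (T p : ℕ) → List ℕ
    rowWords T p = concat (applyUpTo (λ q → entryWord T p q ∷ []) partSize)

    partWords : ℕ → List ℕ
    partWords T = partSize ∷ concat (applyUpTo (rowWords T) partSize)

  printTime : ℕ
  printTime = 6 + partCount * (8 + (2 + (6 + partSize * (8 + (6 + partSize * (8 + suc (size (entryE k))))))))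

  decomposeTime : ℕ
  decomposeTime = 3 + suc (1 + (2 + (2 + (6 + n * 22 + (suc (size (groupLogE k)) + (2 + (6 + groupLog * 12 +
                  (6 + (4 + (suc (size (powerE k)) + (2 + printTime)))))))))))

-- The run of `decompose`

module _ (ℓ : ℝ≥0) (bound : ℕ) (mem : ℕ → ℕ) where

  open Semantics ℓ bound
  open Triples ℓ bound mem

  vertexE-value : ∀ k {eT ep} st → ⟦ vertexE k eT ep ⟧ st ≡
                  vertexAt (registers st 4) (registers st 5) k (⟦ eT ⟧ st) (⟦ ep ⟧ st)
  vertexE-value zero    st = refl
  vertexE-value (suc k) {eT} {ep} st =
    cong (λ v → ⟦ less ⟧ᵒ (⟦ ep ⟧ st) s * (⟦ mod ⟧ᵒ (⟦ eT ⟧ st) (registers st 5) * s + ⟦ ep ⟧ st) +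
                (1 ∸ ⟦ less ⟧ᵒ (⟦ ep ⟧ st) s) * v) (vertexE-value k st)
    where s = registers st 4

  powerE-value : ∀ k {st} → ⟦ powerE k ⟧ st ≡ registers st 5 ^ k
  powerE-value zero    = refl
  powerE-value (suc k) {st} = cong (registers st 5 *_) (powerE-value k)

  module _ (k n : ℕ) (mem0 : mem 0 ≡ n) (mem<bound : ∀ a → mem a < bound) (n<bound : n < bound)
           (1≤n : 1 ≤ n) where

    private
      L   = approx ℓ n
      lg  = logSize k n L
      j   = groupLog k n L
      s   = groupSize k n L
      g   = groupCount k n L
      N   = partSize k n L
      cnt = partCount k n L
      σ : ℕ
      σ = suc (size (entryE k))

    module _ (N<bound : N < bound) (cnt<bound : cnt < bound) (g<bound : g < bound) (j≤lg : j ≤ lg) where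

      Printing : Registers → Set
      Printing ρ = ρ 0 ≡ n × ρ 4 ≡ s × ρ 5 ≡ g × ρ 6 ≡ N × ρ 7 ≡ cnt

      entryE-value : ∀ {ρ T p q} → Printing ρ → ρ 8 ≡ T → ρ 9 ≡ p → ρ 10 ≡ q →
                     ⟦ entryE k ⟧ ⟨ ρ , mem ⟩ ≡ entryWord k n L mem T p q
      entryE-value {ρ} (ρ0 , ρ4 , ρ5 , _) ρ8 ρ9 ρ10
        rewrite vertexE-value k {reg 8} {reg 9} ⟨ ρ , mem ⟩ | vertexE-value k {reg 8} {reg 10} ⟨ ρ , mem ⟩
              | ρ0 | ρ4 | ρ5 | ρ8 | ρ9 | ρ10 = refl

      row-outcome : ∀ {ρ} T p → Printing ρ → ρ 8 ≡ T → ρ 9 ≡ p →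
        Outcome (forLoop 10 6 (print (entryE k))) ρ (rowWords k n L mem T p) (6 + N * (8 + σ))
                (λ ρ → Printing ρ × ρ 8 ≡ T × ρ 9 ≡ p)
      row-outcome T p pr ρ8 ρ9 =
        forLoop-outcome _ (λ _ ρ → Printing ρ × ρ 8 ≡ T × ρ 9 ≡ p) N<bound
          -- The frame condition is `id`, as the invariant reads only registers other than the
          -- counter and lookups at distinct literals reduce.
          (λ ((_ , _ , _ , ρ6 , _) , _) → ρ6) id
          (λ {_} {ρ} _ ρ10 inv@(pr , ρ8 , ρ9) → print-outcome (entryE-value {ρ} pr ρ8 ρ9 ρ10) (mem<bound _) (ρ10 , inv))
          (pr , ρ8 , ρ9)

      part-outcome : ∀ {ρ} T → Printing ρ → ρ 8 ≡ T →
        Outcome (print (reg 6) ⨟ forLoop 9 6 (forLoop 10 6 (print (entryE k)))) ρ (partWords k n L mem T)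
                (2 + (6 + N * (8 + (6 + N * (8 + σ))))) (λ ρ → Printing ρ × ρ 8 ≡ T)
      part-outcome T pr@(_ , _ , _ , ρ6 , _) ρ8 =
        print-outcome {Q = λ ρ → Printing ρ × ρ 8 ≡ T} ρ6 N<bound (pr , ρ8) then λ inv →
        forLoop-outcome _ (λ _ ρ → Printing ρ × ρ 8 ≡ T) N<bound
          (λ ((_ , _ , _ , ρ6 , _) , _) → ρ6) id
          (λ {p} _ ρ9 (pr , ρ8) → ensuring (λ (pr , ρ8 , ρ9) → ρ9 , pr , ρ8) (row-outcome T p pr ρ8 ρ9))
          inv

      parts-outcome : ∀ {ρ} → Printing ρ →
        Outcome (forLoop 8 7 (print (reg 6) ⨟ forLoop 9 6 (forLoop 10 6 (print (entryE k)))))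
                ρ (concat (applyUpTo (partWords k n L mem) cnt)) (printTime k n L) (λ _ → ⊤)
      parts-outcome pr = ensuring (λ _ → tt)
        (forLoop-outcome _ (λ _ → Printing) cnt<bound
          (λ (_ , _ , _ , _ , ρ7) → ρ7) id
          (λ {T} _ ρ8 pr → ensuring (λ (pr , ρ8) → ρ8 , pr) (part-outcome T pr ρ8)) pr)

      Logging : ℕ → Registers → Set
      Logging i ρ = ρ 0 ≡ n × ρ 1 ≡ 2 ^ doublings n i × ρ 2 ≡ doublings n i

      Grouping : ℕ → Registers → Set
      Grouping i ρ = ρ 0 ≡ n × ρ 1 ≡ 2 ^ lg × ρ 3 ≡ j × ρ 4 ≡ 2 ^ i

      lg≤n : lg ≤ n
      lg≤n = doublings≤ n n

      2^lg≤n : 2 ^ lg ≤ n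
      2^lg≤n = 2^doublings≤ n n 1≤n

      log-outcome : ∀ {ρ} → Logging 0 ρ →
        Outcome (forLoop 9 0 (ifnz (op less (reg 0) (op times (lit 2) (reg 1)))
                        skip
                        (set 1 (op times (lit 2) (reg 1)) ⨟ set 2 (op plus (lit 1) (reg 2)))))
                ρ [] (6 + n * 22) (Logging n)
      log-outcome inv = printing (concat-silent n) (forLoop-outcome (λ _ → []) Logging n<bound proj₁ id step inv)
        where
        step : ∀ {x ρ} → x < n → ρ 9 ≡ x → Logging x ρ →
               Outcome (ifnz (op less (reg 0) (op times (lit 2) (reg 1)))
                        skip
                        (set 1 (op times (lit 2) (reg 1)) ⨟ set 2 (op plus (lit 1) (reg 2))))
                       ρ [] 14 (λ ρ → ρ 9 ≡ x × Logging (suc x) ρ)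
        step {x} x<n ρ9 (ρ0 , ρ1 , ρ2)
          -- Abstracting both bounds along with the test turns them, in the `false` case, into
          -- bounds on the values about to be stored, which must be words.
          with n <ᵇ 2 * 2 ^ doublings n x in eq | 2^doublings≤ n (suc x) 1≤n | doublings≤ n (suc x)
        ... | true  | _ | _ = ifnz-outcome true
          (trans (cong₂ (λ a b → ⟦ less ⟧ᵒ a (2 * b)) ρ0 ρ1) (cong (λ c → if c then 1 else 0) eq))
          (λ _ → within (s≤s z≤n) (skip-outcome (ρ9 , ρ0 , ρ1 , ρ2))) (λ ())
        ... | false | 2^≤n | ≤x = ifnz-outcome false
          (trans (cong₂ (λ a b → ⟦ less ⟧ᵒ a (2 * b)) ρ0 ρ1) (cong (λ c → if c then 1 else 0) eq))
          (λ ()) (λ _ → set-then (cong (2 *_) ρ1) (≤-<-trans 2^≤n n<bound)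
                       (set-outcome (cong suc ρ2) (≤-<-trans (≤-trans ≤x x<n) n<bound) (ρ9 , ρ0 , refl , refl)))

      group-outcome : ∀ {ρ} → Grouping 0 ρ →
        Outcome (forLoop 9 3 (set 4 (op times (lit 2) (reg 4)))) ρ [] (6 + j * 12) (Grouping j)
      group-outcome inv = printing (concat-silent j) (forLoop-outcome (λ _ → []) Grouping
        (≤-<-trans (≤-trans j≤lg lg≤n) n<bound)
        (λ (_ , _ , ρ3 , _) → ρ3) id
        (λ x<j ρ9 (ρ0 , ρ1 , ρ3 , ρ4) →
          set-outcome (cong (2 *_) ρ4) (≤-<-trans (≤-trans (^-monoʳ-≤ 2 (≤-trans x<j j≤lg)) 2^lg≤n) n<bound)
                      (ρ9 , ρ0 , ρ1 , ρ3 , refl))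
        inv)

      decompose-outcome : Outcome (decompose k) (λ _ → 0) (cnt ∷ concat (applyUpTo (partWords k n L mem) cnt))
                                  (decomposeTime k n L) (λ _ → ⊤)
      decompose-outcome =
        set-then mem0 n<bound
        (then-outcome (m<n⇒n≢0 1≤n)
          ( set-then refl (≤-<-trans 1≤n n<bound)
          ( set-then refl (≤-<-trans z≤n n<bound)
          ( log-outcome (refl , refl , refl) then λ (ρ0 , ρ1 , ρ2) →
            set-then (cong₂ (λ a b → ⟦ div ⟧ᵒ (b * (k * a)) (k * a + suc (approx ℓ a))) ρ0 ρ2)
                     (≤-<-trans (≤-trans j≤lg lg≤n) n<bound)
          ( set-then refl (≤-<-trans 1≤n n<bound)
          ( group-outcome (ρ0 , ρ1 , refl , refl) then λ (ρ0 , ρ1 , ρ3 , ρ4) →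
            set-then (cong₂ (λ a b → ⟦ div ⟧ᵒ (2 * a) b) ρ1 ρ4) g<bound
          ( set-then (cong (k *_) ρ4) N<bound
          ( set-then (powerE-value k) cnt<bound
          ( print-outcome {Q = Printing} refl cnt<bound (ρ0 , ρ4 , refl , refl , refl) then parts-outcome)))))))))

-- Graphs and their encoding

cells-here : ∀ {n} (f : Fin n → ℕ) ws v → cells (tabulate f ++ ws) (toℕ v) ≡ f v
cells-here f ws zero    = refl
cells-here f ws (suc v) = cells-here (f ∘ suc) ws v

cells-skip : ∀ {n} (f : Fin n → ℕ) ws a → cells (tabulate f ++ ws) (n + a) ≡ cells ws a
cells-skip {zero}  f ws a = refl
cells-skip {suc n} f ws a = cells-skip (f ∘ suc) ws a

cells-matrix : ∀ {m n} (f : Fin m → Fin n → ℕ) u v →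
               cells (concat (tabulate λ u → tabulate (f u))) (toℕ u * n + toℕ v) ≡ f u v
cells-matrix         f zero    v = cells-here (f zero) _ v
cells-matrix {n = n} f (suc u) v = begin-equality
  cells (tabulate (f zero) ++ rows) (n + toℕ u * n + toℕ v)      ≡⟨ cong (cells (tabulate (f zero) ++ rows)) (+-assoc n _ _) ⟩
  cells (tabulate (f zero) ++ rows) (n + (toℕ u * n + toℕ v))    ≡⟨ cells-skip (f zero) rows _ ⟩
  cells rows (toℕ u * n + toℕ v)                                 ≡⟨ cells-matrix (f ∘ suc) u v ⟩
  f (suc u) v                                                    ∎
  where
  rows = concat (tabulate λ u → tabulate (f (suc u)))

cells≤max : ∀ b ws a → cells ws a ≤ foldr _⊔_ b ws
cells≤max b []       a       = z≤n
cells≤max b (w ∷ ws) zero    = m≤m⊔n w _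
cells≤max b (w ∷ ws) (suc a) = ≤-trans (cells≤max b ws a) (m≤n⊔m w _)

base≤max : ∀ b ws → b ≤ foldr _⊔_ b ws
base≤max b []       = ≤-refl
base≤max b (w ∷ ws) = ≤-trans (base≤max b ws) (m≤n⊔m w _)

pullback : ∀ {m n} → (Fin m → Fin n) → WeightedGraph n → WeightedGraph m
pullback φ G .edge u v      = edge G (φ u) (φ v)
pullback φ G .symmetric u v = symmetric G (φ u) (φ v)
pullback φ G .loopless v    = loopless G (φ v)

-- Adjacent vertices are distinct, hence a clique of the pullback keeps its
-- size even if φ is not injective.

pushforward : ∀ {k m n} {φ : Fin m → Fin n} {G : WeightedGraph n} → Clique k (pullback φ G) → Clique k G
pushforward {φ = φ} K .vertex = φ ∘ vertex K
pushforward {φ = φ} {G} K .distinct {i} {j} eq with i Finₚ.≟ j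
... | yes i≡j = i≡j
... | no  i≢j with () ← subst Is-just (trans (cong (edge G _) (sym eq)) (loopless G _)) (adjacent K i j i≢j)
pushforward K .adjacent = adjacent K

module _ {k m n} {φ : Fin m → Fin n} {G : WeightedGraph n} (K : Clique k G)
         (w : Fin k → Fin m) (φw : ∀ i → φ (w i) ≡ vertex K i) where

  lift : Clique k (pullback φ G)
  lift .vertex = w
  lift .distinct eq = distinct K (trans (sym (φw _)) (trans (cong φ eq) (φw _)))
  lift .adjacent i j i≢j = subst₂ (Adjacent G) (sym (φw i)) (sym (φw j)) (adjacent K i j i≢j)

  lift-weight : cliqueWeight lift ≡ cliqueWeight K
  lift-weight = sum-cong-≗ λ i → sum-cong-≗ λ j →
    cong (λ x → if toℕ i <ᵇ toℕ j then x else 0ℤ) (cong₂ (weight G) (φw i) (φw j))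

-- Every clique lies in some part

⟦mod⟧ᵒ-% : ∀ b .{{_ : NonZero b}} a → ⟦ mod ⟧ᵒ a b ≡ a % b
⟦mod⟧ᵒ-% (suc b) a = refl

⟦div⟧ᵒ-/ : ∀ b .{{_ : NonZero b}} a → ⟦ div ⟧ᵒ a b ≡ a / b
⟦div⟧ᵒ-/ (suc b) a = refl

module _ (s g : ℕ) .{{_ : NonZero s}} .{{_ : NonZero g}} where

  vertexAt-here : ∀ k T {p} → p < s → vertexAt s g (suc k) T p ≡ T % g * s + p
  vertexAt-here k T {p} p<s rewrite less-true p<s | ⟦mod⟧ᵒ-% g T = trans (+-identityʳ _) (+-identityʳ _)

  vertexAt-there : ∀ k T p → vertexAt s g (suc k) T (s + p) ≡ vertexAt s g k (T / g) p
  vertexAt-there k T p rewrite less-false (m≤m+n s p) | ⟦div⟧ᵒ-/ g T | m+n∸m≡n s p = +-identityʳ _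

  -- The `i`-th vertex is placed in the `i`-th copy: `v i / s` becomes the `i`-th digit of `T`, and
  -- `v i % s` the position within the copy. Vertices in a common group merely repeat a digit, so no
  -- choice of distinct groups is involved.
  vertexAt-covers : ∀ k (v : Fin k → ℕ) → (∀ i → v i < g * s) →
    ∃[ T ] T < g ^ k × (∀ i → ∃[ p ] p < k * s × vertexAt s g k T p ≡ v i)
  vertexAt-covers zero    v v< = 0 , z<s , λ ()
  vertexAt-covers (suc k) v v< with vertexAt-covers k (v ∘ suc) (v< ∘ suc)
  ... | T , T< , covered = T′ , T′< , covered′
    where
    d = v zero / s
    d<g : d < g
    d<g = m<n*o⇒m/o<n (v< zero)
    T′ = d + T * g
    T′< : T′ < g ^ suc k
    T′< = begin-strict
      d + T * g      <⟨ +-monoˡ-< (T * g) d<g ⟩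
      suc T * g      ≤⟨ *-monoˡ-≤ g T< ⟩
      g ^ k * g      ≡⟨ *-comm (g ^ k) g ⟩
      g * g ^ k      ∎
    T′%g : T′ % g ≡ d
    T′%g = trans ([m+kn]%n≡m%n d T g) (m<n⇒m%n≡m d<g)
    T′/g : T′ / g ≡ T
    T′/g = trans (+-distrib-/-∣ʳ d (n∣m*n T)) (cong₂ _+_ (m<n⇒m/n≡0 d<g) (m*n/n≡m T g))
    covered′ : ∀ i → ∃[ p ] p < suc k * s × vertexAt s g (suc k) T′ p ≡ v i
    covered′ zero = v zero % s , <-≤-trans (m%n<n (v zero) s) (m≤m+n s (k * s)) ,
      trans (vertexAt-here k T′ (m%n<n (v zero) s))
            (trans (cong (λ z → z * s + v zero % s) T′%g)
                   (trans (+-comm (d * s) _) (sym (m≡m%n+[m/n]*n (v zero) s))))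
    covered′ (suc i) with covered i
    ... | p , p< , eq = s + p , +-monoʳ-< s p< ,
      trans (vertexAt-there k T′ p) (trans (cong (λ z → vertexAt s g k z p) T′/g) eq)

concat-singletons : ∀ (f : ℕ → ℕ) n → concat (applyUpTo (λ i → f i ∷ []) n) ≡ applyUpTo f n
concat-singletons f zero    = refl
concat-singletons f (suc n) = cong (f 0 ∷_) (concat-singletons (f ∘ suc) n)

applyUpTo-cong : ∀ {A : Set} {f g : ℕ → A} → f ≗ g → ∀ n → applyUpTo f n ≡ applyUpTo g n
applyUpTo-cong f≗g zero    = refl
applyUpTo-cong f≗g (suc n) = cong₂ _∷_ (f≗g 0) (applyUpTo-cong (f≗g ∘ suc) n)

applyUpTo≡tabulate : ∀ {A : Set} (f : ℕ → A) n → applyUpTo f n ≡ tabulate {n = n} (f ∘ toℕ)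
applyUpTo≡tabulate f zero    = refl
applyUpTo≡tabulate f (suc n) = cong (f 0 ∷_) (applyUpTo≡tabulate (f ∘ suc) n)

module _ (k : ℕ) {n} .{{_ : NonZero n}} (G : WeightedGraph n) (L : ℕ) where

  private
    s   = groupSize k n L
    g   = groupCount k n L
    N   = partSize k n L
    cnt = partCount k n L

  embedding : ℕ → Fin N → Fin n
  embedding T p = fromℕ< (m%n<n (vertexAt s g k T (toℕ p)) n)

  toℕ-embedding : ∀ T p → toℕ (embedding T p) ≡ vertexOf k n L T (toℕ p)
  toℕ-embedding T p = trans (toℕ-fromℕ< _) (sym (⟦mod⟧ᵒ-% n (vertexAt s g k T (toℕ p))))

  pullbacks : List (∃ WeightedGraph)
  pullbacks = applyUpTo (λ T → N , pullback (embedding T) G) cnt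

  length-pullbacks : length pullbacks ≡ cnt
  length-pullbacks = length-applyUpTo _ cnt

  lookup-pullbacks : ∀ i → proj₁ (lookup pullbacks i) ≡ N
  lookup-pullbacks i = cong proj₁ (lookup-applyUpTo (λ T → N , pullback (embedding T) G) cnt i)

  parts-correct : .{{NonZero g}} → n ≤ g * s →
                  HasNegativeClique k G ⇔ Any (λ (_ , H) → HasNegativeClique k H) pullbacks
  parts-correct n≤gs = mk⇔ to from
    where
    instance
      _ : NonZero s
      _ = m^n≢0 2 (groupLog k n L)
    to : HasNegativeClique k G → Any (λ (_ , H) → HasNegativeClique k H) pullbacks
    to (K , K<0) with vertexAt-covers s g k (toℕ ∘ vertex K) (λ i → <-≤-trans (toℕ<n (vertex K i)) n≤gs)
    ... | T , T< , covered = applyUpTo⁺ _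
      (lift {φ = embedding T} K w φw , subst (ℤ._< 0ℤ) (sym (lift-weight {φ = embedding T} K w φw)) K<0) T<
      where
      w : Fin k → Fin N
      w i = fromℕ< (proj₁ (proj₂ (covered i)))
      φw : ∀ i → embedding T (w i) ≡ vertex K i
      φw i = toℕ-injective (begin-equality
        toℕ (embedding T (w i))             ≡⟨ toℕ-fromℕ< _ ⟩
        vertexAt s g k T (toℕ (w i)) % n    ≡⟨ cong (λ p → vertexAt s g k T p % n) (toℕ-fromℕ< _) ⟩
        vertexAt s g k T (proj₁ (covered i)) % n ≡⟨ cong (_% n) (proj₂ (proj₂ (covered i))) ⟩
        toℕ (vertex K i) % n                ≡⟨ m<n⇒m%n≡m (toℕ<n (vertex K i)) ⟩
        toℕ (vertex K i)                    ∎)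
    from : Any (λ (_ , H) → HasNegativeClique k H) pullbacks → HasNegativeClique k G
    from any with applyUpTo⁻ _ any
    -- Weights in the pullback are those of the images by definition, so `K<0` serves unchanged.
    ... | _ , _ , K , K<0 = pushforward K , K<0

  part-words : ∀ T → partWords k n L (cells (encodeGraph G)) T ≡
                     encodeGraph (pullback (embedding T) G)
  part-words T = cong (N ∷_) (cong concat (trans (applyUpTo≡tabulate _ N) (tabulate-cong λ u →
    trans (concat-singletons _ N) (trans (applyUpTo≡tabulate _ N) (tabulate-cong λ v →
    trans (cong₂ (λ a b → cells (encodeGraph G) (1 + (a * n + b)))
             (sym (toℕ-embedding T u)) (sym (toℕ-embedding T v)))
          (cells-matrix _ (embedding T u) (embedding T v)))))))

  parts-words : cnt ∷ concat (applyUpTo (partWords k n L (cells (encodeGraph G))) cnt) ≡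
                encodeAll (NegativeWeightClique k) pullbacks
  parts-words = cong₂ _∷_ (sym length-pullbacks)
    (cong concat (trans (applyUpTo-cong part-words cnt) (sym (map-applyUpTo _ _ cnt))))

-- Running time and output size

-- One loop level: `κ * m` passes of cost `b + c * x`, with the lower-order terms absorbed by
-- `m * x`. Here `κ` is the factor `k` between `s` and the size of a part, or 1 for the loop over
-- parts.
affine-≤ : ∀ a κ m b x c → 1 ≤ m → 1 ≤ x → a + κ * m * (b + c * x) ≤ (a + κ * (b + c)) * (m * x)
affine-≤ a κ m@(suc _) b x@(suc _) c _ _ = begin
  a + κ * m * (b + c * x)                          ≤⟨ +-mono-≤ (m≤m*n a (m * x))
                                                              (*-monoʳ-≤ (κ * m) (+-monoˡ-≤ (c * x) (m≤m*n b x))) ⟩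
  a * (m * x) + κ * m * (b * x + c * x)            ≡⟨ collect a κ m b x c ⟩
  (a + κ * (b + c)) * (m * x)                      ∎
  where
  collect : ∀ a κ m b x c → a * (m * x) + κ * m * (b * x + c * x) ≡ (a + κ * (b + c)) * (m * x)
  collect = solve-∀

module _ (k : ℕ) where

  -- The sums keep the shape produced by `affine-≤`. The 37 collects the fixed costs outside
  -- printing, and 34 is 22 plus 12, the costs per pass of the two loops that compute powers of two.
  rowConstant partConstant timeConstant : ℕ
  rowConstant  = 6 + k * (8 + suc (size (entryE k)))
  partConstant = 6 + k * (8 + rowConstant)
  timeConstant = 37 + size (groupLogE k) + size (powerE k) + 34 + (6 + 1 * (10 + (6 + partConstant)))

module _ (k : ℕ) .{{_ : NonZero k}} (n : ℕ) .{{_ : NonZero n}} (L : ℕ) where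

  private
    lg  = logSize k n L
    j   = groupLog k n L
    i   = lg ∸ j
    s   = groupSize k n L
    g   = groupCount k n L
    N   = partSize k n L
    cnt = partCount k n L
    d   = k * n + suc L

    instance
      d≢0 : NonZero d
      d≢0 = >-nonZero (m≤n⇒m≤o+n (k * n) (s≤s z≤n))
      s≢0 : NonZero s
      s≢0 = m^n≢0 2 j

    j≡ : j ≡ lg * (k * n) / d
    j≡ = ⟦div⟧ᵒ-/ d (lg * (k * n))

  groupLog*d≤ : j * d ≤ lg * (k * n)
  groupLog*d≤ = subst (λ j → j * d ≤ lg * (k * n)) (sym j≡) (m/n*n≤m (lg * (k * n)) d)

  <suc[groupLog]*d : lg * (k * n) < suc j * d
  <suc[groupLog]*d = subst (λ j → lg * (k * n) < suc j * d) (sym j≡) (m<suc[m/n]*n (lg * (k * n)) d)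

  groupLog≤logSize : j ≤ lg
  groupLog≤logSize = *-cancelʳ-≤ j lg d (≤-trans groupLog*d≤ (*-monoʳ-≤ lg (m≤m+n (k * n) (suc L))))

  logSize∸groupLog : i + j ≡ lg
  logSize∸groupLog = m∸n+n≡m groupLog≤logSize

  2^logSize≤ : 2 ^ lg ≤ n
  2^logSize≤ = 2^doublings≤ n n (>-nonZero⁻¹ n)

  groupCount*groupSize : 2 * 2 ^ i * s ≡ 2 * 2 ^ lg
  groupCount*groupSize = trans (*-assoc 2 (2 ^ i) s)
    (cong (2 *_) (trans (sym (^-distribˡ-+-* 2 i j)) (cong (2 ^_) logSize∸groupLog)))

  groupCount≡ : g ≡ 2 * 2 ^ i
  groupCount≡ = trans (⟦div⟧ᵒ-/ s (2 * 2 ^ lg))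
    (trans (cong (_/ s) (sym groupCount*groupSize)) (m*n/n≡m (2 * 2 ^ i) s))

  groups-cover : n ≤ g * s
  groups-cover = subst (n ≤_) (trans (sym groupCount*groupSize) (cong (_* s) (sym groupCount≡))) (<⇒≤ (n<2*2^log n))

  groupCount>0 : 1 ≤ g
  groupCount>0 = subst (1 ≤_) (sym groupCount≡) (m^n>0 2 (suc i))

  groupCount≤ : g ≤ 2 * n
  groupCount≤ = subst (_≤ 2 * n) (sym groupCount≡) (*-monoʳ-≤ 2 (≤-trans (^-monoʳ-≤ 2 (m∸n≤m lg j)) 2^logSize≤))

  partSize≤ : N ≤ k * n
  partSize≤ = *-monoʳ-≤ k (≤-trans (^-monoʳ-≤ 2 groupLog≤logSize) 2^logSize≤)

  partCount≤ : cnt ≤ (2 * n) ^ k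
  partCount≤ = ^-monoˡ-≤ k groupCount≤

  partCount≡ : cnt ≡ 2 ^ k * 2 ^ (k * i)
  partCount≡ = trans (cong (_^ k) groupCount≡) (trans (^-distribʳ-* k 2 (2 ^ i))
    (cong (2 ^ k *_) (trans (^-*-assoc 2 i k) (cong (2 ^_) (*-comm i k)))))

  private
    work : ℕ
    work = cnt * (s * s)

    s>0 : 1 ≤ s
    s>0 = m^n>0 2 j

    cnt>0 : 1 ≤ cnt
    cnt>0 = m^n>0 g {{>-nonZero groupCount>0}} k

    work>0 : 1 ≤ work
    work>0 = *-mono-≤ cnt>0 (*-mono-≤ s>0 s>0)

    -- This absorbs the `n` passes of the logarithm loop.
    n≤work : n ≤ work
    n≤work = begin
      n              ≤⟨ groups-cover ⟩
      g * s          ≤⟨ *-mono-≤ (m≤m^n g k) (m≤m*n s s) ⟩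
      work           ∎
      where
      m≤m^n : ∀ m k .{{_ : NonZero k}} → m ≤ m ^ k
      m≤m^n zero    _       = z≤n
      m≤m^n (suc m) (suc k) = m≤m*n (suc m) (suc m ^ k) {{m^n≢0 (suc m) k}}

    row≤ : 6 + N * (8 + suc (size (entryE k))) ≤ rowConstant k * s
    row≤ = begin
      6 + N * (8 + e)                ≡⟨ cong (λ e → 6 + N * (8 + e)) (*-identityʳ e) ⟨
      6 + N * (8 + e * 1)            ≤⟨ affine-≤ 6 k s 8 1 e s>0 ≤-refl ⟩
      rowConstant k * (s * 1)        ≡⟨ cong (rowConstant k *_) (*-identityʳ s) ⟩
      rowConstant k * s              ∎
      where e = suc (size (entryE k))

    part≤ : 6 + N * (8 + (6 + N * (8 + suc (size (entryE k))))) ≤ partConstant k * (s * s)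
    part≤ = ≤-trans (+-monoʳ-≤ 6 (*-monoʳ-≤ N (+-monoʳ-≤ 8 row≤)))
                    (affine-≤ 6 k s 8 s (rowConstant k) s>0 s>0)

    print≤ : printTime k n L ≤ (6 + 1 * (10 + (6 + partConstant k))) * work
    print≤ = begin
      printTime k n L
        ≤⟨ +-monoʳ-≤ 6 (*-monoʳ-≤ cnt (+-monoʳ-≤ 10 (m≤n⇒m≤o+n (6 * (s * s)) part≤))) ⟩
      6 + cnt * (10 + (6 * (s * s) + partConstant k * (s * s))) ≡⟨ collect cnt (s * s) (partConstant k) ⟩
      6 + 1 * cnt * (10 + (6 + partConstant k) * (s * s))
        ≤⟨ affine-≤ 6 1 cnt 10 (s * s) (6 + partConstant k) cnt>0 (*-mono-≤ s>0 s>0) ⟩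
      (6 + 1 * (10 + (6 + partConstant k))) * work            ∎
      where
      collect : ∀ m x c → 6 + m * (10 + (6 * x + c * x)) ≡ 6 + 1 * m * (10 + (6 + c) * x)
      collect = solve-∀

  decomposeTime≤ : decomposeTime k n L ≤ timeConstant k * 2 ^ k * 2 ^ (k * i + 2 * j)
  decomposeTime≤ = begin
    decomposeTime k n L
      ≡⟨ flatten n (size (groupLogE k)) j (size (powerE k)) (printTime k n L) ⟩
    κ + (22 * n + 12 * j) + printTime k n L
      ≤⟨ +-mono-≤ (+-mono-≤ (≤-trans (≤-reflexive (sym (*-identityʳ κ))) (*-monoʳ-≤ κ work>0))
                            (+-mono-≤ (*-monoʳ-≤ 22 n≤work)
                                      (*-monoʳ-≤ 12 (≤-trans (≤-trans groupLog≤logSize (doublings≤ n n)) n≤work))))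
                  print≤ ⟩
    κ * work + (22 * work + 12 * work) + (6 + 1 * (10 + (6 + partConstant k))) * work
      ≡⟨ collect κ work (6 + 1 * (10 + (6 + partConstant k))) ⟩
    timeConstant k * work
      ≡⟨ cong (timeConstant k *_) work≡ ⟩
    timeConstant k * (2 ^ k * 2 ^ (k * i + 2 * j))
      ≡⟨ *-assoc (timeConstant k) (2 ^ k) _ ⟨
    timeConstant k * 2 ^ k * 2 ^ (k * i + 2 * j)
      ∎
    where
    κ = 37 + size (groupLogE k) + size (powerE k)
    flatten : ∀ n a j b t →
              3 + suc (1 + (2 + (2 + (6 + n * 22 + (suc a + (2 + (6 + j * 12 + (6 + (4 + (suc b + (2 + t)))))))))))
              ≡ 37 + a + b + (22 * n + 12 * j) + t
    flatten = solve-∀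
    collect : ∀ κ w c → κ * w + (22 * w + 12 * w) + c * w ≡ (κ + 34 + c) * w
    collect = solve-∀
    work≡ : work ≡ 2 ^ k * 2 ^ (k * i + 2 * j)
    work≡ = begin-equality
      cnt * (s * s)                              ≡⟨ cong₂ _*_ partCount≡ (trans (sym (^-distribˡ-+-* 2 j j))
                                                                    (cong (λ z → 2 ^ (j + z)) (sym (+-identityʳ j)))) ⟩
      2 ^ k * 2 ^ (k * i) * 2 ^ (2 * j)          ≡⟨ *-assoc (2 ^ k) _ _ ⟩
      2 ^ k * (2 ^ (k * i) * 2 ^ (2 * j))        ≡⟨ cong (2 ^ k *_) (^-distribˡ-+-* 2 (k * i) (2 * j)) ⟨
      2 ^ k * 2 ^ (k * i + 2 * j)                ∎

  partSize-^ᴱ : ∀ ℓ v → approx ℓ n ≡ L → v ≤ N → v ≤ k * 2 ^ 0 · n ^ᴱ α/[α+β] (fromℕ k) ℓ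
  partSize-^ᴱ ℓ v refl v≤ = ^ᴱ-bound (α/[α+β] (fromℕ k) ℓ) lg k 0 j 2^logSize≤ v≤ λ r cut →
    size-exponent k n L lg j ℤ.∣ ↥ r ∣ (↧ₙ r) groupLog*d≤ (α/[α+β]-cut k ℓ n r cut)

  partCount-^ᴱ : ∀ ℓ v → approx ℓ n ≡ L → v ≤ cnt → v ≤ 2 ^ k * 2 ^ (2 + k) · n ^ᴱ αβ/[α+β] (fromℕ k) ℓ
  partCount-^ᴱ ℓ v refl v≤ =
    ^ᴱ-bound (αβ/[α+β] (fromℕ k) ℓ) lg (2 ^ k) (2 + k) (k * i) 2^logSize≤
             (≤-trans v≤ (≤-reflexive partCount≡)) λ r cut →
    count-exponent k n L lg i j ℤ.∣ ↥ r ∣ (↧ₙ r) (doublings≤ n n) logSize∸groupLog <suc[groupLog]*d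
                   (αβ/[α+β]-cut k ℓ n r cut)

-- The total size of the output is about n^(k (λ + 2) / (k + λ)), which increases
-- with λ; Λ is a natural number above λ.

timeExponent : (k : ℕ) .{{_ : NonZero k}} → ℝ≥0 → ℝ≥0
timeExponent k@(suc _) ℓ = fraction (k * (2 + Λ)) (k + Λ)
  where Λ = 3 + approx ℓ 1

timeExponent< : ∀ k ℓ → timeExponent (3 + k) ℓ <ʳ fromℕ (3 + k)
timeExponent< k ℓ = fraction<fromℕ ((3 + k) * (2 + Λ)) (3 + k + Λ) (3 + k)
  (*-monoʳ-< (3 + k) (s<s (s<s (s≤s (m≤n+m Λ k)))))
  where Λ = 3 + approx ℓ 1

decomposeTime-^ᴱ : ∀ k n .{{_ : NonZero n}} ℓ t → t ≤ decomposeTime (3 + k) n (approx ℓ n) →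
  t ≤ timeConstant (3 + k) * 2 ^ (3 + k) * 2 ^ suc k · n ^ᴱ exponent (timeExponent (3 + k) ℓ)
decomposeTime-^ᴱ k n ℓ t t≤ =
  ^ᴱ-bound (exponent (timeExponent (3 + k) ℓ)) l (timeConstant (3 + k) * 2 ^ (3 + k)) (suc k) ((3 + k) * i + 2 * j)
           (2^logSize≤ (3 + k) n L) (≤-trans t≤ (decomposeTime≤ (3 + k) n L)) λ r cut →
  time-exponent (suc k) n L l i j ℤ.∣ ↥ r ∣ (↧ₙ r) {{>-nonZero (m≤n⇒m≤o+n ((3 + k) * n) (s≤s z≤n))}}
    (logSize∸groupLog (3 + k) n L) (<suc[groupLog]*d (3 + k) n L)
    (time-cut (suc k) Λ n L ℤ.∣ ↥ r ∣ (↧ₙ r) (approx-linear ℓ n (>-nonZero⁻¹ n))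
              (fraction-cut ((3 + k) * (2 + Λ)) (3 + k + Λ) r cut))
  where
  Λ = 3 + approx ℓ 1
  L = approx ℓ n
  j = groupLog (3 + k) n L
  l = logSize (3 + k) n L
  i = l ∸ j

-- Word size, complete runs and the theorem

module _ (k : ℕ) .{{_ : NonZero k}} (ℓ : ℝ≥0) where

  -- With `B = 2 + M`, the number of parts is at most `(2 * n) ^ k ≤ B ^ (2 * k)`; the remaining
  -- factors of `B` leave room for strictness.
  wordExponent : ℕ
  wordExponent = 2 + 2 * k

  module _ {n : ℕ} .{{_ : NonZero n}} (M : ℕ) (n≤M : n ≤ M) where

    private
      B     = 2 + M
      bound = B ^ wordExponent

      below : ∀ {v} e → e ≤ 1 + 2 * k → v ≤ B ^ e → v < bound
      below e e≤ v≤ = ≤-<-trans v≤ (^-monoʳ-< B (s<s z<s) (s≤s e≤))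

      k≤B^k : k ≤ B ^ k
      k≤B^k = ≤-trans (<⇒≤ (n<2^n k)) (^-monoˡ-≤ k (s≤s (s≤s z≤n)))

      n≤B : n ≤ B
      n≤B = ≤-trans n≤M (m≤n+m M 2)

      2n≤B² : 2 * n ≤ B ^ 2
      2n≤B² = *-mono-≤ {2} {B} (s≤s (s≤s z≤n)) (≤-trans n≤B (≤-reflexive (sym (*-identityʳ B))))

    M<bound : M < bound
    M<bound = below 1 (s≤s z≤n) (≤-trans (m≤n+m M 2) (≤-reflexive (sym (*-identityʳ B))))

    kn<bound : k * n < bound
    kn<bound = below (1 + k) (s≤s (m≤m+n k _)) (≤-trans (≤-reflexive (*-comm k n)) (*-mono-≤ n≤B k≤B^k))

    2n<bound : 2 * n < bound
    2n<bound = below 2 (s≤s (*-mono-≤ {1} {2} (s≤s z≤n) (>-nonZero⁻¹ k))) 2n≤B²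

    [2n]^k<bound : (2 * n) ^ k < bound
    [2n]^k<bound = below (2 * k) (n≤1+n _) (≤-trans (^-monoˡ-≤ k 2n≤B²) (≤-reflexive (^-*-assoc B 2 k)))

  -- Treated apart because the positions of a part would have no vertex of `G` to map to.
  runEmpty : (G : WeightedGraph 0) → Run (NegativeWeightClique k) (decompose k) ℓ wordExponent G
  runEmpty G = record
    { parts   = []
    ; run     = seq (set 0<bound) (if-else refl (print 0<bound))
    ; correct = mk⇔ (λ (K , _) → noClique k K) λ ()
    }
    where
    open Semantics ℓ (wordBound (NegativeWeightClique k) wordExponent G)
    0<bound : 0 < wordBound (NegativeWeightClique k) wordExponent G
    0<bound = m^n>0 3 wordExponent
    noClique : ∀ {A : Set} k .{{_ : NonZero k}} → Clique k G → A
    noClique (suc k) K with () ← vertex K zero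

  module _ {n : ℕ} .{{_ : NonZero n}} (G : WeightedGraph n) where

    private
      L     = approx ℓ n
      ws    = encodeGraph G
      M     = foldr _⊔_ (n ⊔ length ws) ws
      bound = wordBound (NegativeWeightClique k) wordExponent G

      n≤M : n ≤ M
      n≤M = ≤-trans (m≤m⊔n n (length ws)) (base≤max (n ⊔ length ws) ws)

      M< : M < bound
      M< = M<bound {n} M n≤M

    open Triples ℓ bound (cells ws)

    decompose-run : Outcome (decompose k) (λ _ → 0) (encodeAll (NegativeWeightClique k) (pullbacks k G L))
                            (decomposeTime k n L) _
    decompose-run = printing (parts-words k G L) (decompose-outcome ℓ bound (cells ws) k n refl
      (λ a → ≤-<-trans (cells≤max (n ⊔ length ws) ws a) M<) (≤-<-trans n≤M M<) (>-nonZero⁻¹ n)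
      (≤-<-trans (partSize≤ k n L) (kn<bound M n≤M)) (≤-<-trans (partCount≤ k n L) ([2n]^k<bound M n≤M))
      (≤-<-trans (groupCount≤ k n L) (2n<bound M n≤M)) (groupLog≤logSize k n L))

    runNonempty : Run (NegativeWeightClique k) (decompose k) ℓ wordExponent G
    runNonempty = record
      { parts   = pullbacks k G L
      ; run     = Outcome.exec decompose-run
      ; correct = parts-correct k G L {{>-nonZero (groupCount>0 k n L)}} (groups-cover k n L)
      }

  decompose-runs : ∀ n (G : WeightedGraph n) → Run (NegativeWeightClique k) (decompose k) ℓ wordExponent G
  decompose-runs zero    G = runEmpty G
  decompose-runs (suc n) G = runNonempty G

-- All three bounds hold without logarithmic factors, so the logarithm gets the power 0; the
-- threshold 1 excludes the empty graph.
Õ-constant : ∀ {A : ℕ → Set} (f : ∀ n → A n → ℕ) E C →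
             (∀ n (a : A (suc n)) → f (suc n) a ≤ C · suc n ^ᴱ E) → Õ {A} f E
Õ-constant f E C f≤ = C , 0 , 1 , λ where
  (suc n) _ a → subst (λ M → f (suc n) a ≤ M · suc n ^ᴱ E) (sym (*-identityʳ C)) (f≤ n a)

lemma3p3 : (k : ℕ) → 3 ≤ k → OR-Decomposable (NegativeWeightClique k) (fromℕ k)
lemma3p3 (suc (suc (suc k-3))) (s≤s (s≤s (s≤s z≤n))) =
  -- At index 2, `1 < k` amounts to `2 + 2 < 2 * k`, and `2 * k` is at least 6.
  (2 , ≤-trans (n≤1+n 5) (*-monoʳ-≤ 2 {3} {k} (m≤m+n 3 k-3))) , decompose k , λ ℓ _ →
  let open Run; R = decompose-runs k ℓ in
  timeExponent k ℓ , timeExponent< k-3 ℓ , wordExponent k ℓ , R ,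
  Õ-constant (λ n G → time (R n G)) (exponent (timeExponent k ℓ)) (timeConstant k * 2 ^ k * 2 ^ suc k-3)
    (λ n G → decomposeTime-^ᴱ k-3 (suc n) ℓ (time (R (suc n) G)) (Triples.Outcome.steps≤ (decompose-run k ℓ G))) ,
  Õ-constant (λ n G → length (parts (R n G))) (αβ/[α+β] (fromℕ k) ℓ) (2 ^ k * 2 ^ (2 + k))
    (λ n G → partCount-^ᴱ k (suc n) _ ℓ (length (parts (R (suc n) G))) refl (≤-reflexive (length-pullbacks k G _))) ,
  Õ-constant (λ n (G , i) → proj₁ (lookup (parts (R n G)) i)) (α/[α+β] (fromℕ k) ℓ) (k * 2 ^ 0)
    (λ n (G , i) → partSize-^ᴱ k (suc n) _ ℓ (proj₁ (lookup (parts (R (suc n) G)) i)) refl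
                     (≤-reflexive (lookup-pullbacks k G _ i)))
  where
  k = 3 + k-3
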